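{- Let $m\in\mathbb{Z}_{>0}$ and let $\kappa=(g,g',m)\in S(m)$ satisfy $m=g+g'-p^{s(g)}$. Then $\kappa\in Z(p^{s(g)})$, i.e. $\kappa$ is the center of a connected component of $\Lambda^{\mathrm{bal}}_{>0}$ and $\Delta(\kappa)=p^{s(g)}$.
   Context: Let $p$ be a prime, $\mathbb{F}=\mathbb{F}_p$, $S=\mathbb{F}[x,y]$, $\mathrm{Der}_S=S\partial_x\oplus S\partial_y$. Let $\mathcal{A}=\{H_1,H_2,H_3\}$ with $H_1=\ker x$, $H_2=\ker y$, $H_3=\ker(x+y)$, $\alpha_1=x,\alpha_2=y,\alpha_3=x+y$. For $\mu\in\Lambda\coloneqq\mathbb{Z}_{\ge0}^3$, $D(\mathcal{A},\mu)=\{\theta\in\mathrm{Der}_S:\theta(\alpha_i)\in\alpha_i^{\mu_i}S,\ i=1,2,3\}$; it is free of rank 2 with a homogeneous basis whose degrees (exponents) are unique up to order and sum to $|\mu|=\mu_1+\mu_2+\mu_3$; $\Delta(\mu)$ is the absolute difference of the exponents. $\mu$ is balanced if $\mu_i\le|\mu|/2$ for all $i$; $\Lambda_{>0}=\{\mu:\Delta(\mu)>0\}$, $\Lambda^{\mathrm{bal}}_{>0}$ its balanced part. Elements are adjacent if they differ by $\pm\mathbf{e}_i$; connected components of $\Lambda_{>0}$ are the classes of the equivalence relation generated by adjacency within $\Lambda_{>0}$. It is known (Abe–Numata) that $\Lambda^{\mathrm{bal}}_{>0}$ is a union of connected components of $\Lambda_{>0}$, each of the form $\{\mu:|\mu-\zeta|<\Delta(\zeta)\}$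 for a unique element $\zeta$ (its center), characterized as the unique element of the component with $\Delta(\zeta)>\Delta(\nu)$ for all $\nu$ adjacent to $\zeta$. $Z$ is the set of these centers and $Z(p^k)=\{\zeta\in Z:\Delta(\zeta)=p^k\}$. Write base-$p$ expansions $n=\sum_{e\ge0}c_e(n)p^e$, $0\le c_e(n)<p$, and for $n>0$ let $s(n)=\min\{e:c_e(n)\ne0\}$. Let $G_m=\{g\in\mathbb{Z}_{\ge0}:c_e(g)\le c_e(m)\text{ for all }e\}=\{g_0,\dots,g_t\}$ with $0=g_0<g_1<\dots<g_t=m$, and $S(m)=\{(g_i,g_{t-i+1},m):i\in\{1,\dots,t\}\}$. -}

module Defs where

open import Data.Nat using (ℕ; zero; suc; _+_; _*_; _∸_; _^_; _≤_; _<_; ∣_-_∣; NonZero)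
open import Data.Nat.Properties using (m^n≢0)
open import Data.Nat.DivMod using (_/_; _%_)
open import Data.Nat.Primality using (Prime; prime⇒nonZero)
open import Data.Nat.Combinatorics using (_C_)
open import Data.List using (List; []; _∷_)
open import Data.Product using (Σ; ∃; ∃-syntax; _×_; _,_)
open import Data.Sum using (_⊎_)
open import Relation.Binary.PropositionalEquality using (_≡_; _≢_)
open import Relation.Nullary using (¬_; Dec; yes; no)
open import Data.Nat using (_≟_)
open import Function.Bundles using (_⇔_)

sumUpTo : ℕ → (ℕ → ℕ) → ℕ
sumUpTo zero    f = f 0
sumUpTo (suc n) f = sumUpTo n f + f (suc n)

module Char (p : ℕ) (pr : Prime p) where

  instance
    p≢0 : NonZero p
    p≢0 = prime⇒nonZero pr

  digit : ℕ → ℕ → ℕ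
  digit e n = (_/_ n (p ^ e) {{m^n≢0 p e}}) % p

  IsS : ℕ → ℕ → Set
  IsS n e = digit e n ≢ 0 × (∀ e′ → e′ < e → digit e′ n ≡ 0)

  InG : ℕ → ℕ → Set
  InG m g = ∀ e → digit e g ≤ digit e m

  -- gs is the increasing enumeration g_0 < g_1 < ... < g_t of G_m
  -- (only the values gs 0 .. gs t are meaningful)
  EnumG : ℕ → ℕ → (ℕ → ℕ) → Set
  EnumG m t gs =
      (∀ i j → i < j → j ≤ t → gs i < gs j)
    × (∀ g → InG m g ⇔ (∃[ i ] (i ≤ t × gs i ≡ g)))

  InS : ℕ → ℕ × ℕ × ℕ → Set
  InS m (a , b , c) =
    Σ ℕ λ t → Σ (ℕ → ℕ) λ gs → EnumG m t gs ×
      ∃[ i ] (1 ≤ i × i ≤ t × a ≡ gs i × b ≡ gs (suc (t ∸ i)) × c ≡ m)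

  -- Polynomials in S = F_p[x,y].
  -- A polynomial is a finite dense array of coefficients (natural
  -- numbers, read modulo p); row i, column j is the coefficient of x^i y^j.

  Poly : Set
  Poly = List (List ℕ)

  Coeffs : Set
  Coeffs = ℕ → ℕ → ℕ

  nth : List ℕ → ℕ → ℕ
  nth []       _       = 0
  nth (a ∷ as) zero    = a
  nth (a ∷ as) (suc j) = nth as j

  rowOf : Poly → ℕ → List ℕ
  rowOf []       _       = []
  rowOf (r ∷ rs) zero    = r
  rowOf (r ∷ rs) (suc i) = rowOf rs i

  ⟦_⟧ : Poly → Coeffs
  ⟦ f ⟧ i j = nth (rowOf f i) j

  _≈_ : Coeffs → Coeffs → Set
  f ≈ g = ∀ i j → f i j % p ≡ g i j % p

  zeroC : Coeffs
  zeroC _ _ = 0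

  _⊕_ : Coeffs → Coeffs → Coeffs
  (f ⊕ g) i j = f i j + g i j

  _⊗_ : Coeffs → Coeffs → Coeffs
  (f ⊗ g) i j = sumUpTo i λ a → sumUpTo j λ b → f a b * g (i ∸ a) (j ∸ b)

  xPow : ℕ → Coeffs
  xPow a i j with i ≟ a | j ≟ 0
  ... | yes _ | yes _ = 1
  ... | _     | _     = 0

  yPow : ℕ → Coeffs
  yPow b i j with i ≟ 0 | j ≟ b
  ... | yes _ | yes _ = 1
  ... | _     | _     = 0

  xyPow : ℕ → Coeffs
  xyPow c i j with i + j ≟ c
  ... | yes _ = c C i
  ... | no  _ = 0

  _∣ₛ_ : Coeffs → Coeffs → Set
  a ∣ₛ f = ∃[ h ] (f ≈ (a ⊗ ⟦ h ⟧))

  -- homogeneous of degree d (zero is homogeneous of every degree)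
  Homog : ℕ → Coeffs → Set
  Homog d f = ∀ i j → i + j ≢ d → f i j % p ≡ 0

  -- Derivations θ = f ∂x + g ∂y, so θ(x) = f, θ(y) = g, θ(x+y) = f + g.

  Der : Set
  Der = Poly × Poly

  θx θy : Der → Coeffs
  θx (f , g) = ⟦ f ⟧
  θy (f , g) = ⟦ g ⟧

  Mult : Set
  Mult = ℕ × ℕ × ℕ

  InD : Mult → Der → Set
  InD (μ₁ , μ₂ , μ₃) θ =
      (xPow μ₁ ∣ₛ θx θ) × (yPow μ₂ ∣ₛ θy θ) × (xyPow μ₃ ∣ₛ (θx θ ⊕ θy θ))

  HomogDer : ℕ → Der → Set
  HomogDer d θ = Homog d (θx θ) × Homog d (θy θ)

  HomBasis : Mult → Der → ℕ → Der → ℕ → Set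
  HomBasis μ θ₁ d₁ θ₂ d₂ =
      InD μ θ₁ × InD μ θ₂ × HomogDer d₁ θ₁ × HomogDer d₂ θ₂
    × (∀ θ → InD μ θ → ∃[ f₁ ] ∃[ f₂ ]
         ( (θx θ ≈ ((⟦ f₁ ⟧ ⊗ θx θ₁) ⊕ (⟦ f₂ ⟧ ⊗ θx θ₂)))
         × (θy θ ≈ ((⟦ f₁ ⟧ ⊗ θy θ₁) ⊕ (⟦ f₂ ⟧ ⊗ θy θ₂)))))
    × (∀ f₁ f₂ →
         (((⟦ f₁ ⟧ ⊗ θx θ₁) ⊕ (⟦ f₂ ⟧ ⊗ θx θ₂)) ≈ zeroC) →
         (((⟦ f₁ ⟧ ⊗ θy θ₁) ⊕ (⟦ f₂ ⟧ ⊗ θy θ₂)) ≈ zeroC) →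
         (⟦ f₁ ⟧ ≈ zeroC) × (⟦ f₂ ⟧ ≈ zeroC))

  -- Δ(μ) = δ  (exponents are unique, so this is a functional relation)
  HasΔ : Mult → ℕ → Set
  HasΔ μ δ = ∃[ θ₁ ] ∃[ d₁ ] ∃[ θ₂ ] ∃[ d₂ ] (HomBasis μ θ₁ d₁ θ₂ d₂ × δ ≡ ∣ d₁ - d₂ ∣)

  ∣_∣ₘ : Mult → ℕ
  ∣ (a , b , c) ∣ₘ = a + b + c

  Balanced : Mult → Set
  Balanced μ@(a , b , c) = (2 * a ≤ ∣ μ ∣ₘ) × (2 * b ≤ ∣ μ ∣ₘ) × (2 * c ≤ ∣ μ ∣ₘ)

  data Up : Mult → Mult → Set where
    up₁ : ∀ {a b c} → Up (a , b , c) (suc a , b , c)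
    up₂ : ∀ {a b c} → Up (a , b , c) (a , suc b , c)
    up₃ : ∀ {a b c} → Up (a , b , c) (a , b , suc c)

  Adjacent : Mult → Mult → Set
  Adjacent μ ν = Up μ ν ⊎ Up ν μ

  -- ζ ∈ Z(q): ζ ∈ Λ^bal_{>0} with Δ(ζ) = q, and Δ(ζ) > Δ(ν) for every
  -- ν adjacent to ζ (i.e. ζ is the center of its connected component).
  InZ : ℕ → Mult → Set
  InZ q ζ =
      Balanced ζ × HasΔ ζ q × 0 < q
    × (∀ ν → Adjacent ζ ν → ∀ δ → HasΔ ν δ → δ < q)

-- Put q = p^e and let g₀ be the predecessor of g in G_m.  The involution k ↦ m - k reverses G_m, so
-- g′ = m - g₀ and g = g₀ + q; by Lucas' theorem C(m,i) vanishes mod p for g₀ < i < g but not for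
-- i = g₀ and i = g.  Hence (x+y)^m splits as x^g A + y^g′ B, and (x^g A , y^g′ B) together with
-- (x^g y^g′ , - x^g y^g′) is a basis of D(A,κ), with exponents m and g + g′ = m + q.
-- For a neighbour ν of κ, comparing coefficients of (x+y)^m or (x+y)^(m-1) shows that D(A,ν) has no
-- nonzero homogeneous element of degree below L (L = m + 1 above κ, L = m below κ), while an explicit
-- pair with nonzero determinant of degree |ν| shows that the exponents of ν sum to at most |ν|.
-- As |ν| = 2L + q - 1, the exponents differ by less than q.

module Submission where

open import Algebra.Bundles using (CommutativeRing)
open import Data.Maybe using (nothing)
open import Data.Nat as ℕ using (ℕ; zero; suc)
open import Data.Product using (_,_)
open import Level using (Level; 0ℓ)
open import Relation.Binary.Structures using (IsEquivalence)
open import Tactic.RingSolver using (solve-∀)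
open import Tactic.RingSolver.Core.AlmostCommutativeRing using (AlmostCommutativeRing; fromCommutativeRing)
import Algebra.Properties.CommutativeSemigroup as CommutativeSemigroupProperties
import Relation.Binary.Reasoning.Setoid as SetoidReasoning

-- A neighbour ν comes with no basis of its own: `HasΔ` hands over an arbitrary one, and only its
-- exponents have to be bounded. Two elements of D(A,ν), written in that basis, have a determinant
-- that is a multiple of the determinant of the basis, and the latter has no terms below the sum of
-- the exponents. A single nonzero coefficient in degree |ν| therefore bounds this sum; this takes
-- the role of Saito's criterion. The delicate neighbour is (g, g′, m - 1). Excluding degree m - 1
-- there asks for C(m-1, g-1) to be nonzero modulo p, while m and g may both be divisible by p. The
-- absorption identity m C(m-1, g-1) = g C(m, g) yields this only after division by q, so q must
-- divide m. Here the choice q = p^s(g) enters: q divides g with quotient prime to p, hence divides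
-- g₀ = g - q, and it divides g′ because otherwise G_m would have an element strictly between g₀ and
-- g.

-- Formal power series over a commutative ring.

module PowerSeries {c ℓ : Level} (R : CommutativeRing c ℓ) where
  open CommutativeRing R
  open SetoidReasoning setoid
  open CommutativeSemigroupProperties +-commutativeSemigroup using (interchange)

  Series : Set c
  Series = ℕ → Carrier

  infix 4 _≋_
  _≋_ : Series → Series → Set ℓ
  f ≋ g = ∀ n → f n ≈ g n

  tail : Series → Series
  tail f n = f (suc n)

  infixl 6 _⊞_
  _⊞_ : Series → Series → Series
  (f ⊞ g) n = f n + g n

  infixl 7 _·_ _⊠_
  _·_ : Carrier → Series → Series
  (a · f) n = a * f n

  -- The recursion f g = f(0) g + X (tail f) g replaces the finite convolution sum, so that the ring
  -- laws follow by induction on the degree.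
  _⊠_ : Series → Series → Series
  (f ⊠ g) zero    = f 0 * g 0
  (f ⊠ g) (suc n) = f 0 * g (suc n) + (tail f ⊠ g) n

  0ₛ 1ₛ : Series
  0ₛ _ = 0#
  1ₛ zero    = 1#
  1ₛ (suc _) = 0#

  ⊠-cong : ∀ {f f′ g g′} → f ≋ f′ → g ≋ g′ → f ⊠ g ≋ f′ ⊠ g′
  ⊠-cong f≋ g≋ zero    = *-cong (f≋ 0) (g≋ 0)
  ⊠-cong f≋ g≋ (suc n) = +-cong (*-cong (f≋ 0) (g≋ (suc n))) (⊠-cong (λ k → f≋ (suc k)) g≋ n)

  ⊠-zeroˡ : ∀ g → 0ₛ ⊠ g ≋ 0ₛ
  ⊠-zeroˡ g zero    = zeroˡ _
  ⊠-zeroˡ g (suc n) = trans (+-cong (zeroˡ _) (⊠-zeroˡ g n)) (+-identityˡ 0#)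

  ⊠-identityˡ : ∀ g → 1ₛ ⊠ g ≋ g
  ⊠-identityˡ g zero    = *-identityˡ _
  ⊠-identityˡ g (suc n) = trans (+-cong (*-identityˡ _) (⊠-zeroˡ g n)) (+-identityʳ _)

  ⊠-distribʳ : ∀ h f g → (f ⊞ g) ⊠ h ≋ f ⊠ h ⊞ g ⊠ h
  ⊠-distribʳ h f g zero    = distribʳ _ _ _
  ⊠-distribʳ h f g (suc n) = trans (+-cong (distribʳ _ _ _) (⊠-distribʳ h (tail f) (tail g) n)) (interchange _ _ _ _)

  ⊠-scale : ∀ a f g → (a · f) ⊠ g ≋ a · (f ⊠ g)
  ⊠-scale a f g zero    = *-assoc _ _ _
  ⊠-scale a f g (suc n) = trans (+-cong (*-assoc _ _ _) (⊠-scale a (tail f) g n)) (sym (distribˡ _ _ _))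

  -- The mirror image of the defining recursion, peeling the constant term off the right factor; it
  -- turns commutativity into an induction.
  ⊠-sucʳ : ∀ f g n → (f ⊠ g) (suc n) ≈ f (suc n) * g 0 + (f ⊠ tail g) n
  ⊠-sucʳ f g zero    = +-comm _ _
  ⊠-sucʳ f g (suc n) = begin
    f 0 * g (2 ℕ.+ n) + (tail f ⊠ g) (suc n)
      ≈⟨ +-congˡ (⊠-sucʳ (tail f) g n) ⟩
    f 0 * g (2 ℕ.+ n) + (f (2 ℕ.+ n) * g 0 + (tail f ⊠ tail g) n)
      ≈⟨ x∙yz≈y∙xz _ _ _ ⟩
    f (2 ℕ.+ n) * g 0 + (f 0 * g (2 ℕ.+ n) + (tail f ⊠ tail g) n) ∎
    where open CommutativeSemigroupProperties +-commutativeSemigroup using (x∙yz≈y∙xz)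

  ⊠-comm : ∀ f g → f ⊠ g ≋ g ⊠ f
  ⊠-comm f g zero    = *-comm _ _
  ⊠-comm f g (suc n) = trans (+-cong (*-comm _ _) (⊠-comm (tail f) g n)) (sym (⊠-sucʳ g f n))

  ⊠-assoc : ∀ f g h → (f ⊠ g) ⊠ h ≋ f ⊠ (g ⊠ h)
  ⊠-assoc f g h zero    = *-assoc _ _ _
  ⊠-assoc f g h (suc n) = begin
    f 0 * g 0 * h (suc n) + ((f 0 · tail g ⊞ tail f ⊠ g) ⊠ h) n
      ≈⟨ +-cong (*-assoc _ _ _) (⊠-distribʳ h (f 0 · tail g) (tail f ⊠ g) n) ⟩
    f 0 * (g 0 * h (suc n)) + (((f 0 · tail g) ⊠ h) n + ((tail f ⊠ g) ⊠ h) n)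
      ≈⟨ +-congˡ (+-cong (⊠-scale (f 0) (tail g) h n) (⊠-assoc (tail f) g h n)) ⟩
    f 0 * (g 0 * h (suc n)) + (f 0 * (tail g ⊠ h) n + (tail f ⊠ (g ⊠ h)) n)
      ≈⟨ +-assoc _ _ _ ⟨
    f 0 * (g 0 * h (suc n)) + f 0 * (tail g ⊠ h) n + (tail f ⊠ (g ⊠ h)) n
      ≈⟨ +-congʳ (sym (distribˡ _ _ _)) ⟩
    f 0 * (g ⊠ h) (suc n) + (tail f ⊠ (g ⊠ h)) n ∎

  -- The multiplication is a parameter so that any formula for the Cauchy product can be plugged in.
  module WithProduct (_⊛_ : Series → Series → Series) (⊛≋⊠ : ∀ f g → f ⊛ g ≋ f ⊠ g) where

    commutativeRing : CommutativeRing c ℓ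
    commutativeRing = record
      { Carrier = Series
      ; _≈_ = _≋_
      ; _+_ = _⊞_
      ; _*_ = _⊛_
      ; -_ = λ f n → - f n
      ; 0# = 0ₛ
      ; 1# = 1ₛ
      ; isCommutativeRing = record
        { isRing = record
          { +-isAbelianGroup = record
            { isGroup = record
              { isMonoid = record
                { isSemigroup = record
                  { isMagma = record
                    { isEquivalence = ≋-isEquivalence
                    ; ∙-cong = λ f≋ g≋ n → +-cong (f≋ n) (g≋ n)
                    }
                  ; assoc = λ f g h n → +-assoc _ _ _
                  }
                ; identity = (λ f n → +-identityˡ _) , (λ f n → +-identityʳ _)
                }
              ; inverse = (λ f n → -‿inverseˡ _) , (λ f n → -‿inverseʳ _)
              ; ⁻¹-cong = λ f≋ n → -‿cong (f≋ n)
              }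
            ; comm = λ f g n → +-comm _ _
            }
          ; *-cong = ⊛-cong
          ; *-assoc = λ f g h → ≋-trans (⊛-via (⊛≋⊠ f g) ≋-refl) (≋-trans (⊠-assoc f g h) (≋-sym (⊛-via ≋-refl (⊛≋⊠ g h))))
          ; *-identity = (λ f → ≋-trans (⊛≋⊠ 1ₛ f) (⊠-identityˡ f)) , λ f → ≋-trans (⊛-comm f 1ₛ) (≋-trans (⊛≋⊠ 1ₛ f) (⊠-identityˡ f))
          ; distrib = (λ h f g → ≋-trans (⊛-comm h (f ⊞ g)) (≋-trans (⊛-distribʳ h f g) (⊞-cong (⊛-comm f h) (⊛-comm g h)))) , ⊛-distribʳ
          }
        ; *-comm = ⊛-comm
        }
      }
      where
      ≋-refl : ∀ {f} → f ≋ f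
      ≋-refl n = refl
      ≋-sym : ∀ {f g} → f ≋ g → g ≋ f
      ≋-sym f≋g n = sym (f≋g n)
      ≋-trans : ∀ {f g h} → f ≋ g → g ≋ h → f ≋ h
      ≋-trans f≋g g≋h n = trans (f≋g n) (g≋h n)
      ≋-isEquivalence : IsEquivalence _≋_
      ≋-isEquivalence = record { refl = λ {f} → ≋-refl {f} ; sym = ≋-sym ; trans = ≋-trans }
      ⊞-cong : ∀ {f f′ g g′} → f ≋ f′ → g ≋ g′ → f ⊞ g ≋ f′ ⊞ g′
      ⊞-cong f≋ g≋ n = +-cong (f≋ n) (g≋ n)
      ⊛-via : ∀ {f f′ g g′} → f ≋ f′ → g ≋ g′ → f ⊛ g ≋ f′ ⊠ g′
      ⊛-via {f} {f′} {g} f≋ g≋ = ≋-trans (⊛≋⊠ f g) (⊠-cong f≋ g≋)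
      ⊛-cong : ∀ {f f′ g g′} → f ≋ f′ → g ≋ g′ → f ⊛ g ≋ f′ ⊛ g′
      ⊛-cong {f} {f′} {g} {g′} f≋ g≋ = ≋-trans (⊛-via f≋ g≋) (≋-sym (⊛≋⊠ f′ g′))
      ⊛-comm : ∀ f g → f ⊛ g ≋ g ⊛ f
      ⊛-comm f g = ≋-trans (⊛≋⊠ f g) (≋-trans (⊠-comm f g) (≋-sym (⊛≋⊠ g f)))
      ⊛-distribʳ : ∀ h f g → (f ⊞ g) ⊛ h ≋ (f ⊛ h) ⊞ (g ⊛ h)
      ⊛-distribʳ h f g = ≋-trans (⊛≋⊠ (f ⊞ g) h) (≋-trans (⊠-distribʳ h f g) (⊞-cong (≋-sym (⊛≋⊠ f h)) (≋-sym (⊛≋⊠ g h))))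

module RingIdentities {c ℓ : Level} (R : CommutativeRing c ℓ) where
  open CommutativeRing R using (Carrier)
  R′ : AlmostCommutativeRing c ℓ
  R′ = fromCommutativeRing R (λ _ → nothing)
  open AlmostCommutativeRing R′

  -- Multiplicativity of the 2×2 determinant, expressed through the values at x and at x + y,
  -- with all negative terms moved to the other side.
  det-multiplicative : ∀ a b c d f₁ f₂ g₁ g₂ →
    (f₁ * a + f₂ * b) * ((g₁ * a + g₂ * b) + (g₁ * c + g₂ * d))
      + ((f₁ * g₂) * ((a + c) * b) + (f₂ * g₁) * (a * (b + d)))
    ≈ ((f₁ * a + f₂ * b) + (f₁ * c + f₂ * d)) * (g₁ * a + g₂ * b)
      + ((f₁ * g₂) * (a * (b + d)) + (f₂ * g₁) * ((a + c) * b))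
  det-multiplicative = solve-∀ R′

open import Defs
open import Data.Empty using (⊥-elim)
open import Data.List using (List; []; _∷_; length; applyUpTo)
open import Data.Nat
open import Data.Nat.Combinatorics
open import Data.Nat.DivMod
open import Data.Nat.Divisibility
open import Data.Nat.Primality using (Prime; prime⇒nonTrivial; euclidsLemma)
open import Data.Nat.Properties
open import Data.Product using (∃-syntax; _×_; _,_; proj₁; proj₂)
open import Data.Sum using (_⊎_; inj₁; inj₂; [_,_]′)
open import Function.Bundles using (Equivalence)
open import Relation.Binary.PropositionalEquality
open import Relation.Nullary using (¬_; yes; no)
import Data.Nat.Tactic.RingSolver as ℕ-Solver

-- Identities between binomial coefficients over the natural numbers.

nCk*k!*[n∸k]!≡n! : ∀ {n k} → k ≤ n → (n C k) * (k ! * (n ∸ k) !) ≡ n !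
nCk*k!*[n∸k]!≡n! {n} {k} k≤n =
  trans (cong (_* (k ! * (n ∸ k) !)) (nCk≡n!/k![n-k]! k≤n)) (m/n*n≡m (k![n∸k]!∣n! k≤n))
  where instance _ = k !* (n ∸ k) !≢0

[n+1]*nCk≡[k+1]*[n+1]C[k+1] : ∀ n k → suc n * (n C k) ≡ suc k * (suc n C suc k)
[n+1]*nCk≡[k+1]*[n+1]C[k+1] n k with k ≤? n
... | no k≰n = begin
  suc n * (n C k)          ≡⟨ cong (suc n *_) (k>n⇒nCk≡0 (≰⇒> k≰n)) ⟩
  suc n * 0                ≡⟨ *-zeroʳ (suc n) ⟩
  0                        ≡⟨ *-zeroʳ (suc k) ⟨
  suc k * 0                ≡⟨ cong (suc k *_) (k>n⇒nCk≡0 (s<s (≰⇒> k≰n))) ⟨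
  suc k * (suc n C suc k)  ∎
  where open ≡-Reasoning
... | yes k≤n = *-cancelʳ-≡ _ _ (k ! * (n ∸ k) !) (begin
  suc n * (n C k) * (k ! * (n ∸ k) !)          ≡⟨ *-assoc (suc n) (n C k) _ ⟩
  suc n * ((n C k) * (k ! * (n ∸ k) !))        ≡⟨ cong (suc n *_) (nCk*k!*[n∸k]!≡n! k≤n) ⟩
  suc n !                                      ≡⟨ nCk*k!*[n∸k]!≡n! (s≤s k≤n) ⟨
  (suc n C suc k) * (suc k * k ! * (n ∸ k) !)  ≡⟨ shuffle (suc n C suc k) (suc k) (k !) ((n ∸ k) !) ⟩
  suc k * (suc n C suc k) * (k ! * (n ∸ k) !)  ∎)
  where
  open ≡-Reasoning
  instance _ = k !* (n ∸ k) !≢0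
  shuffle : ∀ a b c d → a * (b * c * d) ≡ b * a * (c * d)
  shuffle = ℕ-Solver.solve-∀

-- Both sides are the trinomial coefficient n! / (a! r! (n-a-r)!); multiplied by its denominator
-- `D`, each becomes `n !`.
trinomial-revision : ∀ {n a r} → a + r ≤ n →
  (n C a) * ((n ∸ a) C r) ≡ (n C (a + r)) * ((a + r) C r)
trinomial-revision {n} {a} {r} a+r≤n = *-cancelʳ-≡ _ _ D (begin
  (n C a) * ((n ∸ a) C r) * D
    ≡⟨ shuffle₁ (n C a) ((n ∸ a) C r) (a !) (r !) _ ⟩
  (n C a) * (a ! * (((n ∸ a) C r) * (r ! * (n ∸ (a + r)) !)))
    ≡⟨ cong (λ z → (n C a) * (a ! * (((n ∸ a) C r) * (r ! * z !)))) (sym (∸-+-assoc n a r)) ⟩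
  (n C a) * (a ! * (((n ∸ a) C r) * (r ! * (n ∸ a ∸ r) !)))
    ≡⟨ cong (λ z → (n C a) * (a ! * z)) (nCk*k!*[n∸k]!≡n! r≤n∸a) ⟩
  (n C a) * (a ! * (n ∸ a) !)
    ≡⟨ nCk*k!*[n∸k]!≡n! (≤-trans (m≤m+n a r) a+r≤n) ⟩
  n !
    ≡⟨ nCk*k!*[n∸k]!≡n! a+r≤n ⟨
  (n C (a + r)) * ((a + r) ! * (n ∸ (a + r)) !)
    ≡⟨ cong (λ z → (n C (a + r)) * (z * (n ∸ (a + r)) !)) (nCk*k!*[n∸k]!≡n! (m≤n+m r a)) ⟨
  (n C (a + r)) * (((a + r) C r) * (r ! * (a + r ∸ r) !) * (n ∸ (a + r)) !)
    ≡⟨ cong (λ z → (n C (a + r)) * (((a + r) C r) * (r ! * z !) * (n ∸ (a + r)) !)) (m+n∸n≡m a r) ⟩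
  (n C (a + r)) * (((a + r) C r) * (r ! * a !) * (n ∸ (a + r)) !)
    ≡⟨ shuffle₂ (n C (a + r)) ((a + r) C r) (a !) (r !) _ ⟩
  (n C (a + r)) * ((a + r) C r) * D ∎)
  where
  open ≡-Reasoning
  D = a ! * r ! * (n ∸ (a + r)) !
  instance
    _ = a !≢0
    _ = r !≢0
    _ = (n ∸ (a + r)) !≢0
    _ = a !* r !≢0
    _ = m*n≢0 (a ! * r !) ((n ∸ (a + r)) !)
  r≤n∸a : r ≤ n ∸ a
  r≤n∸a = m+n≤o⇒m≤o∸n r (≤-trans (≤-reflexive (+-comm r a)) a+r≤n)
  shuffle₁ : ∀ x y a r s → x * y * (a * r * s) ≡ x * (a * (y * (r * s)))
  shuffle₁ = ℕ-Solver.solve-∀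
  shuffle₂ : ∀ x y a r s → x * (y * (r * a) * s) ≡ x * y * (a * r * s)
  shuffle₂ = ℕ-Solver.solve-∀

-- The order-reversing involution g ↦ m ∸ g of {g_0 < ... < g_t} sends g_j to g_{t-j}.
module Reversal
  (m t : ℕ) (gs : ℕ → ℕ)
  (increasing : ∀ i j → i < j → j ≤ t → gs i < gs j)
  (partner : ∀ j → j ≤ t → ∃[ k ] (k ≤ t × gs j + gs k ≡ m))
  where

  partner-decreasing : ∀ {i j k l} → i < j → j ≤ t → k ≤ t → l ≤ t →
    gs i + gs k ≡ m → gs j + gs l ≡ m → l < k
  partner-decreasing {i} {j} {k} {l} i<j j≤t k≤t l≤t gi+gk≡m gj+gl≡m with l <? k
  ... | yes l<k = l<k
  ... | no l≮k = ⊥-elim (<-irrefl (trans gi+gk≡m (sym gj+gl≡m)) (+-mono-<-≤ (increasing i j i<j j≤t) (gk≤gl (m≤n⇒m<n∨m≡n (≮⇒≥ l≮k)))))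
    where
    gk≤gl : k < l ⊎ k ≡ l → gs k ≤ gs l
    gk≤gl (inj₁ k<l) = <⇒≤ (increasing k l k<l l≤t)
    gk≤gl (inj₂ refl) = ≤-refl

  -- Each step up in `j` lowers the index of the partner by at least one, and the descent starts at
  -- an index no larger than `t`.
  partner-≤ : ∀ j {k} → j ≤ t → k ≤ t → gs j + gs k ≡ m → j + k ≤ t
  partner-≤ zero j≤t k≤t _ = k≤t
  partner-≤ (suc j) {k} j≤t k≤t eq with partner j (<⇒≤ j≤t)
  ... | k′ , k′≤t , eq′ = ≤-trans
    (≤-trans (≤-reflexive (sym (+-suc j k))) (+-monoʳ-≤ j (partner-decreasing (n<1+n j) j≤t k′≤t k≤t eq′ eq)))
    (partner-≤ j (<⇒≤ j≤t) k′≤t eq′)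

  -- Between `j` and `t` there are `d` further steps, each lowering the index of the partner, so
  -- that index is at least `d` to begin with.
  partner-≥ : ∀ d {j k} → j + d ≡ t → k ≤ t → gs j + gs k ≡ m → t ≤ j + k
  partner-≥ zero {j} {k} j+0≡t _ _ = ≤-trans (≤-reflexive (trans (sym j+0≡t) (+-identityʳ j))) (m≤m+n j k)
  partner-≥ (suc d) {j} {k} j+d≡t k≤t eq with partner (suc j) j<t
    where
    j<t : suc j ≤ t
    j<t = ≤-trans (m≤m+n (suc j) d) (≤-reflexive (trans (sym (+-suc j d)) j+d≡t))
  ... | k′ , k′≤t , eq′ = ≤-trans (partner-≥ d (trans (sym (+-suc j d)) j+d≡t) k′≤t eq′)
    (≤-trans (≤-reflexive (sym (+-suc j k′))) (+-monoʳ-≤ j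
      (partner-decreasing (n<1+n j) j<t k≤t k′≤t eq eq′)))
    where
    j<t : suc j ≤ t
    j<t = ≤-trans (m≤m+n (suc j) d) (≤-reflexive (trans (sym (+-suc j d)) j+d≡t))

  partner-index : ∀ {j k} → j ≤ t → k ≤ t → gs j + gs k ≡ m → j + k ≡ t
  partner-index {j} j≤t k≤t eq =
    ≤-antisym (partner-≤ j j≤t k≤t eq) (partner-≥ (t ∸ j) (m+[n∸m]≡n j≤t) k≤t eq)

-- Binomial coefficients modulo p and base-p digits.

module BinomialMod (p : ℕ) (pr : Prime p) where
  open Char p pr

  infix 4 _≡ₚ_
  _≡ₚ_ : ℕ → ℕ → Set
  a ≡ₚ b = a % p ≡ b % p

  ∣⇒≡ₚ0 : ∀ {a} → p ∣ a → a ≡ₚ 0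
  ∣⇒≡ₚ0 {a} p∣a = trans (n∣m⇒m%n≡0 a p p∣a) (sym (0%n≡0 p))
    where
    0%n≡0 : ∀ n .{{_ : NonZero n}} → 0 % n ≡ 0
    0%n≡0 n = n∣m⇒m%n≡0 0 n (n ∣0)

  ∣∣⇒≡ₚ : ∀ {a b} → p ∣ a → p ∣ b → a ≡ₚ b
  ∣∣⇒≡ₚ p∣a p∣b = trans (∣⇒≡ₚ0 p∣a) (sym (∣⇒≡ₚ0 p∣b))

  ≡ₚ-∣ : ∀ {a b} → a ≡ₚ b → p ∣ b → p ∣ a
  ≡ₚ-∣ {a} {b} a≡b p∣b = m%n≡0⇒n∣m a p (trans a≡b (n∣m⇒m%n≡0 b p p∣b))

  +-congₚ : ∀ {a b c d} → a ≡ₚ b → c ≡ₚ d → a + c ≡ₚ b + d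
  +-congₚ {a} {b} {c} {d} a≡b c≡d =
    trans (%-distribˡ-+ a c p) (trans (cong₂ (λ x y → (x + y) % p) a≡b c≡d) (sym (%-distribˡ-+ b d p)))

  *-congₚ : ∀ {a b c d} → a ≡ₚ b → c ≡ₚ d → a * c ≡ₚ b * d
  *-congₚ {a} {b} {c} {d} a≡b c≡d =
    trans (%-distribˡ-* a c p) (trans (cong₂ (λ x y → (x * y) % p) a≡b c≡d) (sym (%-distribˡ-* b d p)))

  1<p : 1 < p
  1<p = nonTrivial⇒n>1 p {{prime⇒nonTrivial pr}}

  0<p : 0 < p
  0<p = <⇒≤ 1<p

  p∤1 : ¬ p ∣ 1
  p∤1 = >⇒∤ 1<p

  p∤n! : ∀ {n} → n < p → ¬ p ∣ n !
  p∤n! {zero} _ = p∤1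
  p∤n! {suc n} n<p p∣ with euclidsLemma (suc n) (n !) pr p∣
  ... | inj₁ p∣1+n = >⇒∤ n<p p∣1+n
  ... | inj₂ p∣n! = p∤n! (<⇒≤ n<p) p∣n!

  p∤* : ∀ {a b} → ¬ p ∣ a → ¬ p ∣ b → ¬ p ∣ a * b
  p∤* {a} {b} p∤a p∤b p∣ab = [ p∤a , p∤b ]′ (euclidsLemma a b pr p∣ab)

  p∣pCk : ∀ {k} → 0 < k → k < p → p ∣ p C k
  p∣pCk {k} 0<k k<p with euclidsLemma (p C k) (k ! * (p ∸ k) !) pr
                       (subst (p ∣_) (sym (nCk*k!*[n∸k]!≡n! (<⇒≤ k<p))) (p∣p! 0<p))
    where
    p∣p! : ∀ {n} → 0 < n → n ∣ n !
    p∣p! {suc n} _ = m∣m*n (n !)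
  ... | inj₁ p∣C = p∣C
  ... | inj₂ p∣k! = ⊥-elim (p∤* (p∤n! k<p) (p∤n! (∸-monoʳ-< 0<k (<⇒≤ k<p))) p∣k!)

  p∤rCs : ∀ {r s} → r < p → s ≤ r → ¬ p ∣ r C s
  p∤rCs {r} {s} r<p s≤r p∣ = p∤n! r<p (subst (p ∣_) (nCk*k!*[n∸k]!≡n! s≤r) (∣m⇒∣m*n _ p∣))

  -- Modulo p, (1+X)^(n+p) = (1+X)^n (1+X^p). This is the comparison of coefficients below X^p, and
  -- `[n+p]C[k+p]≡` the one from X^p on; both are proved by Pascal's rule alone.
  [n+p]Ck≡nCk : ∀ n {k} → k < p → (n + p) C k ≡ₚ n C k
  [n+p]Ck≡nCk n {zero} _ = refl
  [n+p]Ck≡nCk zero {suc k} k<p = ∣∣⇒≡ₚ (p∣pCk z<s k<p) (p ∣0)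
  [n+p]Ck≡nCk (suc n) {suc k} k<p = begin
    ((suc n + p) C suc k) % p               ≡⟨ cong (_% p) (nCk+nC[k+1]≡[n+1]C[k+1] (n + p) k) ⟨
    ((n + p) C k + (n + p) C suc k) % p     ≡⟨ +-congₚ {c = (n + p) C suc k} ([n+p]Ck≡nCk n (<⇒≤ k<p)) ([n+p]Ck≡nCk n k<p) ⟩
    (n C k + n C suc k) % p                 ≡⟨ cong (_% p) (nCk+nC[k+1]≡[n+1]C[k+1] n k) ⟩
    (suc n C suc k) % p                     ∎
    where open ≡-Reasoning

  [n+p]C[k+p]≡ : ∀ n k → (n + p) C (k + p) ≡ₚ n C (k + p) + n C k
  [n+p]C[k+p]≡ zero zero = cong (_% p) (begin
    p C p          ≡⟨ nCn≡1 p ⟩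
    1              ≡⟨ cong (_+ 1) (k>n⇒nCk≡0 0<p) ⟨
    0 C p + 0 C 0  ∎)
    where open ≡-Reasoning
  [n+p]C[k+p]≡ zero (suc k) = cong (_% p) (trans (k>n⇒nCk≡0 (m<1+n⇒m≤n (s<s (s≤s (m≤n+m p k))))) refl)
  -- Pascal's rule needs `p` in successor form, and a module parameter cannot be matched on, so a
  -- copy with an equation stands in for it.
  [n+p]C[k+p]≡ (suc n) zero = aux p refl
    where
    aux : ∀ p′ → p′ ≡ p → (suc n + p) C p′ ≡ₚ suc n C p′ + suc n C 0
    aux zero 0≡p = ⊥-elim (<-irrefl 0≡p 0<p)
    aux (suc k) 1+k≡p = begin
      ((suc n + p) C suc k) % p
        ≡⟨ cong (_% p) (nCk+nC[k+1]≡[n+1]C[k+1] (n + p) k) ⟨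
      ((n + p) C k + (n + p) C suc k) % p
        ≡⟨ +-congₚ {c = (n + p) C suc k} ([n+p]Ck≡nCk n (≤-reflexive 1+k≡p))
             (subst (λ z → (n + p) C z ≡ₚ n C z + n C 0) (sym 1+k≡p) ([n+p]C[k+p]≡ n 0)) ⟩
      (n C k + (n C suc k + 1)) % p
        ≡⟨ cong (_% p) (+-assoc (n C k) (n C suc k) 1) ⟨
      (n C k + n C suc k + 1) % p
        ≡⟨ cong (λ z → (z + 1) % p) (nCk+nC[k+1]≡[n+1]C[k+1] n k) ⟩
      (suc n C suc k + 1) % p ∎
      where open ≡-Reasoning
  [n+p]C[k+p]≡ (suc n) (suc k) = begin
    ((suc n + p) C (suc k + p)) % p
      ≡⟨ cong (_% p) (nCk+nC[k+1]≡[n+1]C[k+1] (n + p) (k + p)) ⟨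
    ((n + p) C (k + p) + (n + p) C (suc k + p)) % p
      ≡⟨ +-congₚ {c = (n + p) C (suc k + p)} ([n+p]C[k+p]≡ n k) ([n+p]C[k+p]≡ n (suc k)) ⟩
    (n C (k + p) + n C k + (n C (suc k + p) + n C suc k)) % p
      ≡⟨ cong (_% p) (shuffle (n C (k + p)) (n C k) (n C (suc k + p)) (n C suc k)) ⟩
    (n C (k + p) + n C (suc k + p) + (n C k + n C suc k)) % p
      ≡⟨ cong₂ (λ x y → (x + y) % p) (nCk+nC[k+1]≡[n+1]C[k+1] n (k + p)) (nCk+nC[k+1]≡[n+1]C[k+1] n k) ⟩
    (suc n C (suc k + p) + suc n C suc k) % p ∎
    where
    open ≡-Reasoning
    shuffle : ∀ a b c d → a + b + (c + d) ≡ a + c + (b + d)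
    shuffle = ℕ-Solver.solve-∀

  -- Removing `p` from both arguments obeys Pascal's rule by the two congruences above, so the
  -- induction is that of Pascal's triangle for `n C k` with the factor `r C s` carried along.
  lucas-step : ∀ n k {r s} → r < p → s < p →
    (n * p + r) C (k * p + s) ≡ₚ (n C k) * (r C s)
  lucas-step zero zero {r} {s} _ _ = cong (_% p) (sym (+-identityʳ (r C s)))
  lucas-step zero (suc k) {r} {s} r<p _ =
    cong (_% p) (k>n⇒nCk≡0 {r} (<-≤-trans r<p (≤-trans (m≤m+n p (k * p)) (m≤m+n (p + k * p) s))))
  lucas-step (suc n) zero {r} {s} r<p s<p = begin
    ((p + n * p + r) C s) % p  ≡⟨ cong (λ z → (z C s) % p) (+-assoc p (n * p) r) ⟩
    ((p + (n * p + r)) C s) % p  ≡⟨ cong (λ z → (z C s) % p) (+-comm p (n * p + r)) ⟩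
    ((n * p + r + p) C s) % p  ≡⟨ [n+p]Ck≡nCk (n * p + r) s<p ⟩
    ((n * p + r) C s) % p      ≡⟨ lucas-step n zero r<p s<p ⟩
    (1 * (r C s)) % p          ∎
    where open ≡-Reasoning
  lucas-step (suc n) (suc k) {r} {s} r<p s<p = begin
    ((p + n * p + r) C (p + k * p + s)) % p
      ≡⟨ cong₂ (λ x y → (x C y) % p) (move (n * p) r) (move (k * p) s) ⟩
    ((n * p + r + p) C (k * p + s + p)) % p
      ≡⟨ [n+p]C[k+p]≡ (n * p + r) (k * p + s) ⟩
    ((n * p + r) C (k * p + s + p) + (n * p + r) C (k * p + s)) % p
      ≡⟨ cong (λ z → ((n * p + r) C z + (n * p + r) C (k * p + s)) % p) (move (k * p) s) ⟨
    ((n * p + r) C (p + k * p + s) + (n * p + r) C (k * p + s)) % p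
      ≡⟨ +-congₚ {c = (n * p + r) C (k * p + s)} (lucas-step n (suc k) r<p s<p) (lucas-step n k r<p s<p) ⟩
    ((n C suc k) * (r C s) + (n C k) * (r C s)) % p
      ≡⟨ cong (_% p) (*-distribʳ-+ (r C s) (n C suc k) (n C k)) ⟨
    ((n C suc k + n C k) * (r C s)) % p
      ≡⟨ cong (λ z → (z * (r C s)) % p) (trans (+-comm (n C suc k) (n C k)) (nCk+nC[k+1]≡[n+1]C[k+1] n k)) ⟩
    ((suc n C suc k) * (r C s)) % p ∎
    where
    open ≡-Reasoning
    move : ∀ x y → p + x + y ≡ x + y + p
    move x y = trans (+-assoc p x y) (+-comm p (x + y))

  lucas : ∀ m k → m C k ≡ₚ ((m / p) C (k / p)) * ((m % p) C (k % p))
  lucas m k = trans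
    (cong₂ (λ x y → (x C y) % p) (divMod m) (divMod k))
    (lucas-step (m / p) (k / p) (m%n<n m p) (m%n<n k p))
    where
    divMod : ∀ n → n ≡ n / p * p + n % p
    divMod n = trans (m≡m%n+[m/n]*n n p) (+-comm (n % p) (n / p * p))

  [p*n]C[p*k]≡nCk : ∀ n k → (p * n) C (p * k) ≡ₚ n C k
  [p*n]C[p*k]≡nCk n k = begin
    ((p * n) C (p * k)) % p          ≡⟨ cong₂ (λ x y → (x C y) % p) (expand n) (expand k) ⟩
    ((n * p + 0) C (k * p + 0)) % p  ≡⟨ lucas-step n k 0<p 0<p ⟩
    ((n C k) * 1) % p                ≡⟨ cong (_% p) (*-identityʳ (n C k)) ⟩
    (n C k) % p                      ∎
    where
    open ≡-Reasoning
    expand : ∀ n → p * n ≡ n * p + 0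
    expand n = trans (*-comm p n) (sym (+-identityʳ (n * p)))

  -- The `e` zero digits shared by both arguments drop off one at a time, which leaves `n C 1`.
  [p^e*n]C[p^e]≡n : ∀ e n → (p ^ e * n) C (p ^ e) ≡ₚ n
  [p^e*n]C[p^e]≡n zero n = cong (_% p) (trans (cong (_C 1) (*-identityˡ n)) (nC1≡n n))
  [p^e*n]C[p^e]≡n (suc e) n = begin
    ((p * p ^ e * n) C (p * p ^ e)) % p    ≡⟨ cong (λ z → (z C (p * p ^ e)) % p) (*-assoc p (p ^ e) n) ⟩
    ((p * (p ^ e * n)) C (p * p ^ e)) % p  ≡⟨ [p*n]C[p*k]≡nCk (p ^ e * n) (p ^ e) ⟩
    ((p ^ e * n) C (p ^ e)) % p            ≡⟨ [p^e*n]C[p^e]≡n e n ⟩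
    n % p                                  ∎
    where open ≡-Reasoning

  digit-zero : ∀ n → digit 0 n ≡ n % p
  digit-zero n = cong (_% p) (n/1≡n n)

  digit-suc : ∀ e n → digit (suc e) n ≡ digit e (n / p)
  digit-suc e n = cong (_% p) (sym (m/n/o≡m/[n*o] n p (p ^ e)))
    where instance
      _ = m^n≢0 p e
      _ = m^n≢0 p (suc e)

  private
    /p-shrinks : ∀ {n N} → n ≤ suc N → n / p ≤ N
    /p-shrinks {zero} _ = ≤-trans (≤-reflexive (0/n≡0 p)) z≤n
    /p-shrinks {suc n} (s≤s n≤N) = ≤-trans (m<1+n⇒m≤n (m/n<m (suc n) p 1<p)) n≤N

    -- Lucas splits off the lowest digits, and `r C s` with `r`, `s` below p is a unit modulo p
    -- exactly when `s ≤ r`. The remaining call is on quotients by `p`, which is not structural; `N`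
    -- bounds both arguments and shrinks with them.
    InG⇒p∤C-fuelled : ∀ N {m k} → m ≤ N → k ≤ N → InG m k → ¬ p ∣ m C k
    InG⇒p∤C-fuelled zero z≤n z≤n _ = p∤1
    InG⇒p∤C-fuelled (suc N) {m} {k} m≤ k≤ k∈G p∣ =
      p∤* (InG⇒p∤C-fuelled N (/p-shrinks m≤) (/p-shrinks k≤) (λ e → subst₂ _≤_ (digit-suc e k) (digit-suc e m) (k∈G (suc e))))
          (p∤rCs (m%n<n m p) (subst₂ _≤_ (digit-zero k) (digit-zero m) (k∈G 0)))
          (≡ₚ-∣ (sym (lucas m k)) p∣)

    p∤C⇒InG-fuelled : ∀ N {m k} → m ≤ N → k ≤ N → ¬ p ∣ m C k → InG m k
    p∤C⇒InG-fuelled zero z≤n z≤n _ _ = ≤-refl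
    p∤C⇒InG-fuelled (suc N) {m} {k} m≤ k≤ p∤ zero = subst₂ _≤_ (sym (digit-zero k)) (sym (digit-zero m)) (≮⇒≥ m%p≮k%p)
      where
      m%p≮k%p : ¬ (m % p < k % p)
      m%p≮k%p m<k = p∤ (≡ₚ-∣ (lucas m k) (∣n⇒∣m*n ((m / p) C (k / p)) (subst (p ∣_) (sym (k>n⇒nCk≡0 m<k)) (p ∣0))))
    p∤C⇒InG-fuelled (suc N) {m} {k} m≤ k≤ p∤ (suc e) = subst₂ _≤_ (sym (digit-suc e k)) (sym (digit-suc e m))
      (p∤C⇒InG-fuelled N (/p-shrinks m≤) (/p-shrinks k≤) (λ p∣ → p∤ (≡ₚ-∣ (lucas m k) (∣m⇒∣m*n _ p∣))) e)

  InG⇒p∤C : ∀ m k → InG m k → ¬ p ∣ m C k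
  InG⇒p∤C m k = InG⇒p∤C-fuelled (m + k) (m≤m+n m k) (m≤n+m k m)

  p∤C⇒InG : ∀ m k → ¬ p ∣ m C k → InG m k
  p∤C⇒InG m k = p∤C⇒InG-fuelled (m + k) (m≤m+n m k) (m≤n+m k m)

  p∤C⇒≤ : ∀ m k → ¬ p ∣ m C k → k ≤ m
  p∤C⇒≤ m k p∤ = ≮⇒≥ (λ m<k → p∤ (subst (p ∣_) (sym (k>n⇒nCk≡0 m<k)) (p ∣0)))

  p^-pos : ∀ e → 0 < p ^ e
  p^-pos e = m^n>0 p e

  IsS⇒≡p^*unit : ∀ e {n} → IsS n e → ∃[ u ] (n ≡ p ^ e * u × ¬ p ∣ u)
  IsS⇒≡p^*unit zero {n} (d≢0 , _) =
    n , sym (*-identityˡ n) , λ p∣n → d≢0 (trans (digit-zero n) (n∣m⇒m%n≡0 n p p∣n))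
  IsS⇒≡p^*unit (suc e) {n} (d≢0 , low)
    with IsS⇒≡p^*unit e {n / p} ((λ eq → d≢0 (trans (digit-suc e n) eq)) ,
           λ e′ e′<e → trans (sym (digit-suc e′ n)) (low (suc e′) (s<s e′<e)))
  ... | u , eq , p∤u = u , trans n≡ (trans (cong (p *_) eq) (sym (*-assoc p (p ^ e) u))) , p∤u
    where
    n≡ : n ≡ p * (n / p)
    n≡ = sym (m*[n/m]≡n (m%n≡0⇒n∣m n p (trans (sym (digit-zero n)) (low 0 z<s))))

  p-adic-split : ∀ e n → (∃[ w ] n ≡ p ^ e * w) ⊎ (∃[ f ] ∃[ w ] (f < e × n ≡ p ^ f * w × ¬ p ∣ w))
  p-adic-split zero n = inj₁ (n , sym (*-identityˡ n))
  p-adic-split (suc e) n with p ∣? n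
  ... | no p∤n = inj₂ (0 , n , z<s , sym (*-identityˡ n) , p∤n)
  ... | yes p∣n with p-adic-split e (n / p)
  ...   | inj₁ (w , eq) = inj₁ (w , trans (sym (m*[n/m]≡n p∣n)) (trans (cong (p *_) eq) (sym (*-assoc p (p ^ e) w))))
  ...   | inj₂ (f , w , f<e , eq , p∤w) =
    inj₂ (suc f , w , s<s f<e , trans (sym (m*[n/m]≡n p∣n)) (trans (cong (p *_) eq) (sym (*-assoc p (p ^ f) w))) , p∤w)

  -- What membership in S(m) says about binomial coefficients.

  -- The arithmetic content of κ = (g , g′ , m) ∈ S(m) with m = g + g′ - q;
  -- g₀ is the predecessor of g in G_m.
  record CenterData (g g′ m q : ℕ) : Set where
    field
      g₀        : ℕ
      g≡        : g ≡ g₀ + q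
      m≡        : m ≡ g₀ + g′
      0<q       : 0 < q
      q≤g′      : q ≤ g′
      p∤mCg     : ¬ p ∣ m C g
      p∤mCg₀    : ¬ p ∣ m C g₀
      p∣between : ∀ {i} → g₀ < i → i < g → p ∣ m C i
      p∤[m-1]C[g-1] : ¬ p ∣ (m ∸ 1) C (g ∸ 1)

  InS⇒CenterData : ∀ {m g g′ e} → 0 < m → InS m (g , g′ , m) → IsS g e → m + p ^ e ≡ g + g′ →
    CenterData g g′ m (p ^ e)
  InS⇒CenterData {m} {g} {g′} {e} 0<m (t , gs , (increasing , enum) , i , 1≤i , i≤t , g≡gsi , g′≡ , _) isS m+q≡g+g′ =
    record
      { g₀ = g₀ ; g≡ = g≡ ; m≡ = m≡ ; 0<q = p^-pos e ; q≤g′ = q≤g′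
      ; p∤mCg = p∤mCg ; p∤mCg₀ = p∤mCg₀ ; p∣between = between ; p∤[m-1]C[g-1] = p∤[m-1]C[g-1] }
    where
    open Equivalence
    q = p ^ e
    split = IsS⇒≡p^*unit e isS
    u = proj₁ split
    g≡q*u : g ≡ q * u
    g≡q*u = proj₁ (proj₂ split)
    p∤u : ¬ p ∣ u
    p∤u = proj₂ (proj₂ split)

    gs∈G : ∀ j → j ≤ t → ¬ p ∣ m C gs j
    gs∈G j j≤t = InG⇒p∤C m (gs j) (from (enum (gs j)) (j , j≤t , refl))

    -- That k ↦ m - k preserves G_m is read off from the symmetry of binomial coefficients rather
    -- than from the digits.
    reflect : ∀ k → ¬ p ∣ m C k → ¬ p ∣ m C (m ∸ k)
    reflect k p∤ p∣ = p∤ (subst (p ∣_) (sym (nCk≡nC[n∸k] {k} {m} (p∤C⇒≤ m k p∤))) p∣)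

    partner : ∀ j → j ≤ t → ∃[ k ] (k ≤ t × gs j + gs k ≡ m)
    partner j j≤t with to (enum (m ∸ gs j)) (p∤C⇒InG m (m ∸ gs j) (reflect (gs j) (gs∈G j j≤t)))
    ... | k , k≤t , eq = k , k≤t , trans (cong (gs j +_) eq) (m+[n∸m]≡n (p∤C⇒≤ m (gs j) (gs∈G j j≤t)))

    open Reversal m t gs increasing partner

    i⁻ = i ∸ 1
    i≡ : suc i⁻ ≡ i
    i≡ = m+[n∸m]≡n 1≤i
    i⁻<t : suc i⁻ ≤ t
    i⁻<t = ≤-trans (≤-reflexive i≡) i≤t
    g₀ = gs i⁻

    j′ = suc (t ∸ i)
    j′≤t : j′ ≤ t
    j′≤t = ∸-monoʳ-< 1≤i i≤t
    j′+i⁻≡t : j′ + i⁻ ≡ t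
    j′+i⁻≡t = trans (sym (+-suc (t ∸ i) i⁻)) (trans (cong (t ∸ i +_) i≡) (m∸n+n≡m i≤t))

    -- The indices i - 1 and t - i + 1 add up to t, so `partner-index` identifies `g₀` as the
    -- partner of `g′`.
    g₀+g′≡m : g₀ + g′ ≡ m
    g₀+g′≡m with partner j′ j′≤t
    ... | k , k≤t , eq = trans (+-comm g₀ g′)
      (trans (cong₂ _+_ g′≡ (cong gs (+-cancelˡ-≡ j′ i⁻ k (trans j′+i⁻≡t (sym (partner-index j′≤t k≤t eq)))))) eq)

    m≡ : m ≡ g₀ + g′
    m≡ = sym g₀+g′≡m
    g≡ : g ≡ g₀ + q
    g≡ = +-cancelʳ-≡ g′ g (g₀ + q) (trans (sym m+q≡g+g′) (trans (cong (_+ q) m≡) (shuffle g₀ g′ q)))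
      where
      shuffle : ∀ a b c → a + b + c ≡ a + c + b
      shuffle = ℕ-Solver.solve-∀

    p∤mCg : ¬ p ∣ m C g
    p∤mCg = subst (λ z → ¬ p ∣ m C z) (sym g≡gsi) (gs∈G i i≤t)
    p∤mCg₀ : ¬ p ∣ m C g₀
    p∤mCg₀ = gs∈G i⁻ (<⇒≤ i⁻<t)
    q≤g′ : q ≤ g′
    q≤g′ = +-cancelˡ-≤ g₀ q g′ (subst₂ _≤_ g≡ m≡ (p∤C⇒≤ m g p∤mCg))

    between : ∀ {k} → g₀ < k → k < g → p ∣ m C k
    between {k} g₀<k k<g with p ∣? (m C k)
    ... | yes p∣ = p∣
    ... | no p∤ with to (enum k) (p∤C⇒InG m k p∤)
    ...   | j , j≤t , gsj≡k = ⊥-elim (<⇒≱ i⁻<j (s≤s⁻¹ (≤-trans j<i (≤-reflexive (sym i≡)))))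
      where
      monotone : ∀ {a b} → b ≤ t → a ≤ b → gs a ≤ gs b
      monotone {a} {b} b≤t a≤b with m≤n⇒m<n∨m≡n a≤b
      ... | inj₁ a<b = <⇒≤ (increasing a b a<b b≤t)
      ... | inj₂ refl = ≤-refl
      i⁻<j : i⁻ < j
      i⁻<j = ≰⇒> (λ j≤i⁻ → <⇒≱ (subst (g₀ <_) (sym gsj≡k) g₀<k) (monotone (<⇒≤ i⁻<t) j≤i⁻))
      j<i : j < i
      j<i = ≰⇒> (λ i≤j → <⇒≱ (subst₂ _<_ (sym gsj≡k) g≡gsi k<g) (monotone j≤t i≤j))

    -- If g′ had smaller p-adic valuation f than g, then g₀ + p^f ∈ G_m would lie strictly between g₀ and g.
    q∣g′ : ∃[ w ] g′ ≡ q * w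
    q∣g′ with p-adic-split e g′
    ... | inj₁ q∣g′ = q∣g′
    ... | inj₂ (f , w , f<e , g′≡rw , p∤w) = ⊥-elim (p∤* p∤mCg₀ p∤g′Cr
      (subst (p ∣_) (sym (trinomial-revision {m} {g₀} {r} g₀+r≤m)) (∣m⇒∣m*n _ (between (m<m+n g₀ (p^-pos f)) g₀+r<g))))
      where
      r = p ^ f
      r<q : r < q
      r<q = ^-monoʳ-< p 1<p f<e
      g₀+r≤m : g₀ + r ≤ m
      g₀+r≤m = ≤-trans (+-monoʳ-≤ g₀ (≤-trans (<⇒≤ r<q) q≤g′)) (≤-reflexive g₀+g′≡m)
      g₀+r<g : g₀ + r < g
      g₀+r<g = <-≤-trans (+-monoʳ-< g₀ r<q) (≤-reflexive (sym g≡))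
      -- Here `m ∸ g₀` is g′ = p^f w, and its binomial coefficient at p^f is w modulo p.
      p∤g′Cr : ¬ p ∣ (m ∸ g₀) C r
      p∤g′Cr p∣ = p∤w (≡ₚ-∣ (sym ([p^e*n]C[p^e]≡n f w))
        (subst (λ z → p ∣ z C r) (trans (cong (_∸ g₀) m≡) (trans (m+n∸m≡n g₀ g′) g′≡rw)) p∣))

    g₀≡ : ∃[ v ] g₀ ≡ q * v
    g₀≡ = u ∸ 1 , +-cancelʳ-≡ q g₀ (q * (u ∸ 1)) (trans (sym g≡) (trans g≡q*u
      (trans (cong (q *_) (sym (trans (+-comm (u ∸ 1) 1) (m+[n∸m]≡n 0<u))))
        (trans (*-distribˡ-+ q (u ∸ 1) 1) (cong (q * (u ∸ 1) +_) (*-identityʳ q))))))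
      where
      0<u : 0 < u
      0<u = n≢0⇒n>0 (λ u≡0 → p∤u (subst (p ∣_) (sym u≡0) (p ∣0)))

    w = proj₁ g₀≡ + proj₁ q∣g′
    m≡q*w : m ≡ q * w
    m≡q*w = trans m≡ (trans (cong₂ _+_ (proj₂ g₀≡) (proj₂ q∣g′)) (sym (*-distribˡ-+ q (proj₁ g₀≡) (proj₁ q∣g′))))

    -- Absorption reads m C(m-1, g-1) = g C(m, g), where m and g may both vanish modulo p. Both are
    -- multiples of q; once q is cancelled over the naturals, the right-hand side is u C(m, g),
    -- which is prime to p.
    p∤[m-1]C[g-1] : ¬ p ∣ (m ∸ 1) C (g ∸ 1)
    p∤[m-1]C[g-1] p∣ = p∤* p∤u p∤mCg (subst (p ∣_) w*≡u* (∣n⇒∣m*n w p∣))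
      where
      0<g : 0 < g
      0<g = <-≤-trans (p^-pos e) (≤-trans (m≤n+m q g₀) (≤-reflexive (sym g≡)))
      absorb : m * ((m ∸ 1) C (g ∸ 1)) ≡ g * (m C g)
      absorb = subst₂ (λ x y → x * ((m ∸ 1) C (g ∸ 1)) ≡ y * (x C y)) (m+[n∸m]≡n 0<m) (m+[n∸m]≡n 0<g)
        ([n+1]*nCk≡[k+1]*[n+1]C[k+1] (m ∸ 1) (g ∸ 1))
      w*≡u* : w * ((m ∸ 1) C (g ∸ 1)) ≡ u * (m C g)
      w*≡u* = *-cancelˡ-≡ _ _ q {{m^n≢0 p e}} (begin
        q * (w * ((m ∸ 1) C (g ∸ 1)))  ≡⟨ *-assoc q w _ ⟨
        q * w * ((m ∸ 1) C (g ∸ 1))    ≡⟨ cong (_* ((m ∸ 1) C (g ∸ 1))) m≡q*w ⟨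
        m * ((m ∸ 1) C (g ∸ 1))        ≡⟨ absorb ⟩
        g * (m C g)                    ≡⟨ cong (_* (m C g)) g≡q*u ⟩
        q * u * (m C g)                ≡⟨ *-assoc q u _ ⟩
        q * (u * (m C g))              ∎)
        where open ≡-Reasoning

-- Coefficient arrays as the ring of power series in x and y over the field with p elements.

sumUpTo-cong : ∀ n {F G} → (∀ i → F i ≡ G i) → sumUpTo n F ≡ sumUpTo n G
sumUpTo-cong zero    F≡G = F≡G 0
sumUpTo-cong (suc n) F≡G = cong₂ _+_ (sumUpTo-cong n F≡G) (F≡G (suc n))

sumUpTo-head : ∀ n F → sumUpTo (suc n) F ≡ F 0 + sumUpTo n (λ i → F (suc i))
sumUpTo-head zero    F = refl
sumUpTo-head (suc n) F = trans (cong (_+ F (suc (suc n))) (sumUpTo-head n F)) (+-assoc (F 0) _ _)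

module Bivariate (p : ℕ) (pr : Prime p) where
  open Char p pr
  open BinomialMod p pr

  -- The carrier stays ℕ, with congruence as equality, to match the raw coefficients of `Coeffs`.
  -- Hence the negative of `a` is (p - 1) a.
  ℤ/p : CommutativeRing 0ℓ 0ℓ
  ℤ/p = record
    { Carrier = ℕ
    ; _≈_ = _≡ₚ_
    ; _+_ = _+_
    ; _*_ = _*_
    ; -_ = λ a → pred p * a
    ; 0# = 0
    ; 1# = 1
    ; isCommutativeRing = record
      { isRing = record
        { +-isAbelianGroup = record
          { isGroup = record
            { isMonoid = record
              { isSemigroup = record
                { isMagma = record
                  { isEquivalence = record { refl = refl ; sym = sym ; trans = trans }
                  ; ∙-cong = λ {a} {b} {c} → +-congₚ {a} {b} {c}
                  }
                ; assoc = λ a b c → cong (_% p) (+-assoc a b c)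
                }
              ; identity = (λ a → refl) , (λ a → cong (_% p) (+-identityʳ a))
              }
            ; inverse = (λ a → trans (cong (_% p) (+-comm (pred p * a) a)) (inverseʳ a)) , inverseʳ
            ; ⁻¹-cong = λ {a} {b} → *-congₚ {pred p} {pred p} {a} {b} refl
            }
          ; comm = λ a b → cong (_% p) (+-comm a b)
          }
        ; *-cong = λ {a} {b} {c} → *-congₚ {a} {b} {c}
        ; *-assoc = λ a b c → cong (_% p) (*-assoc a b c)
        ; *-identity = (λ a → cong (_% p) (*-identityˡ a)) , (λ a → cong (_% p) (*-identityʳ a))
        ; distrib = (λ a b c → cong (_% p) (*-distribˡ-+ a b c)) , (λ a b c → cong (_% p) (*-distribʳ-+ a b c))
        }
      ; *-comm = λ a b → cong (_% p) (*-comm a b)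
      }
    }
    where
    inverseʳ : ∀ a → a + pred p * a ≡ₚ 0
    inverseʳ a = ∣⇒≡ₚ0 (subst (λ z → p ∣ z * a) (sym (suc-pred p)) (m∣m*n a))

  -- Row `i` of an array is the coefficient of x^i, itself a series in y; iterating the construction
  -- makes `Coeffs` the carrier of the ring in both variables.
  module Row = PowerSeries ℤ/p
  rowRing : CommutativeRing 0ℓ 0ℓ
  rowRing = Row.WithProduct.commutativeRing Row._⊠_ (λ f g n → refl)

  module Array = PowerSeries rowRing

  row-product : ∀ u v j → sumUpTo j (λ b → u b * v (j ∸ b)) ≡ (u Row.⊠ v) j
  row-product u v zero    = refl
  row-product u v (suc j) = trans (sumUpTo-head j _) (cong (u 0 * v (suc j) +_) (row-product (Row.tail u) v j))

  ⊗-product : ∀ f g i j → (f ⊗ g) i j ≡ (f Array.⊠ g) i j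
  ⊗-product f g i j = trans (sumUpTo-cong i (λ a → row-product (f a) (g (i ∸ a)) j)) (rows f i)
    where
    rows : ∀ f i → sumUpTo i (λ a → (f a Row.⊠ g (i ∸ a)) j) ≡ (f Array.⊠ g) i j
    rows f zero    = refl
    rows f (suc i) = trans (sumUpTo-head i _) (cong ((f 0 Row.⊠ g (suc i)) j +_) (rows (Array.tail f) i))

  -- Identities are computed among power series, free of finiteness conditions; finite support
  -- matters only where a witness has to be a `Poly`.
  𝔽[[x,y]] : CommutativeRing 0ℓ 0ℓ
  𝔽[[x,y]] = Array.WithProduct.commutativeRing _⊗_ (λ f g i j → cong (_% p) (⊗-product f g i j))

  sum-zero : ∀ n {F} → (∀ i → i ≤ n → p ∣ F i) → p ∣ sumUpTo n F
  sum-zero zero    z = z 0 z≤n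
  sum-zero (suc n) z = ∣m∣n⇒∣m+n (sum-zero n (λ i i≤n → z i (m≤n⇒m≤1+n i≤n))) (z (suc n) ≤-refl)

  sum-single : ∀ n {F k} → k ≤ n → (∀ i → i ≤ n → i ≢ k → p ∣ F i) → sumUpTo n F ≡ₚ F k
  sum-single zero z≤n z = refl
  sum-single (suc n) {F} {k} k≤ z with m≤n⇒m<n∨m≡n k≤
  ... | inj₂ refl = %-remove-+ˡ (F (suc n)) (sum-zero n (λ i i≤n → z i (m≤n⇒m≤1+n i≤n) (<⇒≢ (s≤s i≤n))))
  ... | inj₁ (s≤s k≤n) = trans (%-remove-+ʳ (sumUpTo n F) (z (suc n) ≤-refl (λ eq → <⇒≢ (s≤s k≤n) (sym eq))))
    (sum-single n k≤n (λ i i≤n → z i (m≤n⇒m≤1+n i≤n)))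

  ⊗-zero : ∀ f g {i j} → (∀ a b → a ≤ i → b ≤ j → p ∣ f a b ⊎ p ∣ g (i ∸ a) (j ∸ b)) → p ∣ (f ⊗ g) i j
  ⊗-zero f g {i} {j} z = sum-zero i (λ a a≤i → sum-zero j (λ b b≤j →
    [ ∣m⇒∣m*n _ , ∣n⇒∣m*n (f a b) ]′ (z a b a≤i b≤j)))

  ⊗-single : ∀ f g {i j k l} → k ≤ i → l ≤ j →
    (∀ a b → a ≤ i → b ≤ j → p ∣ f a b ⊎ (a ≡ k × b ≡ l)) →
    (f ⊗ g) i j ≡ₚ f k l * g (i ∸ k) (j ∸ l)
  ⊗-single f g {i} {j} {k} {l} k≤i l≤j z = trans
    (sum-single i k≤i (λ a a≤i a≢k → sum-zero j (λ b b≤j → off a b a≤i b≤j (λ (a≡k , _) → a≢k a≡k))))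
    (sum-single j l≤j (λ b b≤j b≢l → off k b k≤i b≤j (λ (_ , b≡l) → b≢l b≡l)))
    where
    off : ∀ a b → a ≤ i → b ≤ j → ¬ (a ≡ k × b ≡ l) → p ∣ f a b * g (i ∸ a) (j ∸ b)
    off a b a≤i b≤j ≢kl with z a b a≤i b≤j
    ... | inj₁ p∣ = ∣m⇒∣m*n _ p∣
    ... | inj₂ ≡kl = ⊥-elim (≢kl ≡kl)

  -- Order, homogeneity, and multiplication by powers of x, y and x + y.

  Order≥ : ℕ → Coeffs → Set
  Order≥ d f = ∀ i j → i + j < d → p ∣ f i j

  private
    regroup : ∀ {i j a b} → a ≤ i → b ≤ j → i + j ≡ (a + b) + ((i ∸ a) + (j ∸ b))
    regroup {i} {j} {a} {b} a≤i b≤j = trans (cong₂ _+_ (sym (m+[n∸m]≡n a≤i)) (sym (m+[n∸m]≡n b≤j))) (shuffle a (i ∸ a) b (j ∸ b))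
      where
      shuffle : ∀ a c b d → (a + c) + (b + d) ≡ (a + b) + (c + d)
      shuffle = ℕ-Solver.solve-∀

  Order≥-⊗ : ∀ d e {f g} → Order≥ d f → Order≥ e g → Order≥ (d + e) (f ⊗ g)
  Order≥-⊗ d e {f} {g} f≥ g≥ i j i+j< = ⊗-zero f g low
    where
    low : ∀ a b → a ≤ i → b ≤ j → p ∣ f a b ⊎ p ∣ g (i ∸ a) (j ∸ b)
    low a b a≤i b≤j with a + b <? d
    ... | yes a+b<d = inj₁ (f≥ a b a+b<d)
    ... | no a+b≮d = inj₂ (g≥ _ _ (+-cancelˡ-< d _ _ (≤-<-trans (+-monoˡ-≤ _ (≮⇒≥ a+b≮d))
                       (subst (_< d + e) (regroup a≤i b≤j) i+j<))))

  HomogOf : ℕ → Coeffs → Set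
  HomogOf d f = ∀ i j → i + j ≢ d → p ∣ f i j

  HomogOf⇒Homog : ∀ {d f} → HomogOf d f → Homog d f
  HomogOf⇒Homog h i j i+j≢d = n∣m⇒m%n≡0 _ p (h i j i+j≢d)

  Homog⇒HomogOf : ∀ {d f} → Homog d f → HomogOf d f
  Homog⇒HomogOf h i j i+j≢d = m%n≡0⇒n∣m _ p (h i j i+j≢d)

  HomogOf-resp : ∀ {d f g} → f ≈ g → HomogOf d g → HomogOf d f
  HomogOf-resp f≈g h i j i+j≢d = ≡ₚ-∣ (f≈g i j) (h i j i+j≢d)

  HomogOf⇒Order≥ : ∀ {d f} → HomogOf d f → Order≥ d f
  HomogOf⇒Order≥ h i j i+j<d = h i j (<⇒≢ i+j<d)

  HomogOf-⊗ : ∀ {d e f g} → HomogOf d f → HomogOf e g → HomogOf (d + e) (f ⊗ g)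
  HomogOf-⊗ {d} {e} {f} {g} hf hg i j i+j≢ = ⊗-zero f g off
    where
    off : ∀ a b → a ≤ i → b ≤ j → p ∣ f a b ⊎ p ∣ g (i ∸ a) (j ∸ b)
    off a b a≤i b≤j with a + b ≟ d
    ... | no a+b≢d = inj₁ (hf a b a+b≢d)
    ... | yes a+b≡d = inj₂ (hg _ _ (λ eq → i+j≢ (trans (regroup a≤i b≤j) (cong₂ _+_ a+b≡d eq))))

  HomogOf-⊕ : ∀ {d f g} → HomogOf d f → HomogOf d g → HomogOf d (f ⊕ g)
  HomogOf-⊕ hf hg i j i+j≢d = ∣m∣n⇒∣m+n (hf i j i+j≢d) (hg i j i+j≢d)

  xPow-on : ∀ a → xPow a a 0 ≡ 1
  xPow-on a with a ≟ a
  ... | yes _ = refl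
  ... | no a≢a = ⊥-elim (a≢a refl)

  xPow-off : ∀ a i j → xPow a i j ≡ 0 ⊎ (i ≡ a × j ≡ 0)
  xPow-off a i j with i ≟ a | j ≟ 0
  ... | yes i≡a | yes j≡0 = inj₂ (i≡a , j≡0)
  ... | yes _ | no _ = inj₁ refl
  ... | no _ | yes _ = inj₁ refl
  ... | no _ | no _ = inj₁ refl

  yPow-on : ∀ b → yPow b 0 b ≡ 1
  yPow-on b with b ≟ b
  ... | yes _ = refl
  ... | no b≢b = ⊥-elim (b≢b refl)

  yPow-off : ∀ b i j → yPow b i j ≡ 0 ⊎ (i ≡ 0 × j ≡ b)
  yPow-off b i j with i ≟ 0 | j ≟ b
  ... | yes i≡0 | yes j≡b = inj₂ (i≡0 , j≡b)
  ... | yes _ | no _ = inj₁ refl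
  ... | no _ | yes _ = inj₁ refl
  ... | no _ | no _ = inj₁ refl

  xyPow-on : ∀ c i j → i + j ≡ c → xyPow c i j ≡ c C i
  xyPow-on c i j i+j≡c with i + j ≟ c
  ... | yes _ = refl
  ... | no i+j≢c = ⊥-elim (i+j≢c i+j≡c)

  xyPow-off : ∀ c i j → i + j ≢ c → xyPow c i j ≡ 0
  xyPow-off c i j i+j≢c with i + j ≟ c
  ... | yes i+j≡c = ⊥-elim (i+j≢c i+j≡c)
  ... | no _ = refl

  ≡0⇒p∣ : ∀ {n} → n ≡ 0 → p ∣ n
  ≡0⇒p∣ refl = p ∣0

  xPow-homog : ∀ a → HomogOf a (xPow a)
  xPow-homog a i j i+j≢a with xPow-off a i j
  ... | inj₁ ≡0 = ≡0⇒p∣ ≡0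
  ... | inj₂ (i≡a , j≡0) = ⊥-elim (i+j≢a (trans (cong₂ _+_ i≡a j≡0) (+-identityʳ a)))

  yPow-homog : ∀ b → HomogOf b (yPow b)
  yPow-homog b i j i+j≢b with yPow-off b i j
  ... | inj₁ ≡0 = ≡0⇒p∣ ≡0
  ... | inj₂ (i≡0 , j≡b) = ⊥-elim (i+j≢b (cong₂ _+_ i≡0 j≡b))

  xyPow-homog : ∀ c → HomogOf c (xyPow c)
  xyPow-homog c i j i+j≢c = ≡0⇒p∣ (xyPow-off c i j i+j≢c)

  x-shift : ∀ a f i j → (xPow a ⊗ f) (a + i) j ≡ₚ f i j
  x-shift a f i j = trans (⊗-single (xPow a) f {a + i} {j} {a} {0} (m≤m+n a i) z≤n (λ k l _ _ → on k l))
    (cong (_% p) (trans (cong₂ _*_ (xPow-on a) (cong (λ z → f z j) (m+n∸m≡n a i))) (*-identityˡ (f i j))))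
    where
    on : ∀ k l → p ∣ xPow a k l ⊎ (k ≡ a × l ≡ 0)
    on k l with xPow-off a k l
    ... | inj₁ ≡0 = inj₁ (≡0⇒p∣ ≡0)
    ... | inj₂ eqs = inj₂ eqs

  y-shift : ∀ b f i j → (yPow b ⊗ f) i (b + j) ≡ₚ f i j
  y-shift b f i j = trans (⊗-single (yPow b) f {i} {b + j} {0} {b} z≤n (m≤m+n b j) (λ k l _ _ → on k l))
    (cong (_% p) (trans (cong₂ _*_ (yPow-on b) (cong (f i) (m+n∸m≡n b j))) (*-identityˡ (f i j))))
    where
    on : ∀ k l → p ∣ yPow b k l ⊎ (k ≡ 0 × l ≡ b)
    on k l with yPow-off b k l
    ... | inj₁ ≡0 = inj₁ (≡0⇒p∣ ≡0)
    ... | inj₂ eqs = inj₂ eqs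

  x-below : ∀ a f {i} j → i < a → p ∣ (xPow a ⊗ f) i j
  x-below a f {i} j i<a = ⊗-zero (xPow a) f off
    where
    off : ∀ k l → k ≤ i → l ≤ j → p ∣ xPow a k l ⊎ p ∣ f (i ∸ k) (j ∸ l)
    off k l k≤i _ with xPow-off a k l
    ... | inj₁ ≡0 = inj₁ (≡0⇒p∣ ≡0)
    ... | inj₂ (k≡a , _) = ⊥-elim (<⇒≱ i<a (subst (_≤ i) k≡a k≤i))

  y-below : ∀ b f i {j} → j < b → p ∣ (yPow b ⊗ f) i j
  y-below b f i {j} j<b = ⊗-zero (yPow b) f off
    where
    off : ∀ k l → k ≤ i → l ≤ j → p ∣ yPow b k l ⊎ p ∣ f (i ∸ k) (j ∸ l)
    off k l _ l≤j with yPow-off b k l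
    ... | inj₁ ≡0 = inj₁ (≡0⇒p∣ ≡0)
    ... | inj₂ (_ , l≡b) = ⊥-elim (<⇒≱ j<b (subst (_≤ j) l≡b l≤j))

  xy-lead : ∀ c f {i j} → i + j ≡ c → (xyPow c ⊗ f) i j ≡ₚ (c C i) * f 0 0
  xy-lead c f {i} {j} i+j≡c = trans (⊗-single (xyPow c) f {i} {j} ≤-refl ≤-refl on)
    (cong (_% p) (cong₂ _*_ (xyPow-on c i j i+j≡c) (cong₂ f (n∸n≡0 i) (n∸n≡0 j))))
    where
    on : ∀ a b → a ≤ i → b ≤ j → p ∣ xyPow c a b ⊎ (a ≡ i × b ≡ j)
    on a b a≤i b≤j with a + b ≟ c
    ... | no a+b≢c = inj₁ (p ∣0)
    ... | yes a+b≡c = inj₂ (a≡i , +-cancelˡ-≡ i b j (trans (cong (_+ b) (sym a≡i)) a+b≡i+j))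
      where
      a+b≡i+j : a + b ≡ i + j
      a+b≡i+j = trans a+b≡c (sym i+j≡c)
      a≡i : a ≡ i
      a≡i = ≤-antisym a≤i (+-cancelʳ-≤ b i a (≤-trans (+-monoʳ-≤ i b≤j) (≤-reflexive (sym a+b≡i+j))))

  module S = CommutativeRing 𝔽[[x,y]]

  xyPow-1 : xyPow 1 ≈ (xPow 1 ⊕ yPow 1)
  xyPow-1 0 0 = refl
  xyPow-1 0 1 = refl
  xyPow-1 0 (suc (suc j)) = refl
  xyPow-1 1 0 = refl
  xyPow-1 1 (suc j) = refl
  xyPow-1 (suc (suc i)) zero = refl
  xyPow-1 (suc (suc i)) (suc j) = refl

  xyPow-1-⊗ : ∀ f → (xyPow 1 ⊗ f) ≈ ((xPow 1 ⊗ f) ⊕ (yPow 1 ⊗ f))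
  xyPow-1-⊗ f = S.trans (S.*-cong {xyPow 1} {xPow 1 ⊕ yPow 1} {f} xyPow-1 S.refl) (S.distribʳ f (xPow 1) (yPow 1))

  xyPow-0 : xyPow 0 ≈ S.1#
  xyPow-0 0 0 = refl
  xyPow-0 0 (suc j) = refl
  xyPow-0 (suc i) j = refl

  xyPow-pascal : ∀ c i j → xyPow (suc c) (suc i) (suc j) ≡ xyPow c i (suc j) + xyPow c (suc i) j
  xyPow-pascal c i j with i + suc j ≟ c
  ... | yes i+1+j≡c = begin
    xyPow (suc c) (suc i) (suc j)           ≡⟨ xyPow-on (suc c) (suc i) (suc j) (cong suc i+1+j≡c) ⟩
    suc c C suc i                           ≡⟨ nCk+nC[k+1]≡[n+1]C[k+1] c i ⟨
    c C i + c C suc i                       ≡⟨ cong (c C i +_) (xyPow-on c (suc i) j (trans (sym (+-suc i j)) i+1+j≡c)) ⟨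
    c C i + xyPow c (suc i) j               ∎
    where open ≡-Reasoning
  ... | no i+1+j≢c = trans (xyPow-off (suc c) (suc i) (suc j) (λ eq → i+1+j≢c (suc-injective eq)))
    (sym (xyPow-off c (suc i) j (λ eq → i+1+j≢c (trans (+-suc i j) eq))))

  xyPow-suc : ∀ c → xyPow (suc c) ≈ (xyPow 1 ⊗ xyPow c)
  xyPow-suc c = S.trans pascal (S.sym (xyPow-1-⊗ (xyPow c)))
    where
    g = xyPow c
    xyPow-top : ∀ i → xyPow (suc c) (suc i) 0 ≡ xyPow c i 0
    xyPow-top i with i + 0 ≟ c
    ... | no i+0≢c = xyPow-off (suc c) (suc i) 0 (λ eq → i+0≢c (suc-injective eq))
    ... | yes i+0≡c = begin
      xyPow (suc c) (suc i) 0  ≡⟨ xyPow-on (suc c) (suc i) 0 (cong suc i+0≡c) ⟩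
      suc c C suc i            ≡⟨ nCk+nC[k+1]≡[n+1]C[k+1] c i ⟨
      c C i + c C suc i        ≡⟨ cong (c C i +_) (k>n⇒nCk≡0 (s≤s (≤-reflexive (trans (sym i+0≡c) (+-identityʳ i))))) ⟩
      c C i + 0                ≡⟨ +-identityʳ (c C i) ⟩
      c C i                    ∎
      where open ≡-Reasoning
    xyPow-bottom : ∀ j → xyPow (suc c) 0 (suc j) ≡ xyPow c 0 j
    xyPow-bottom j with j ≟ c
    ... | yes refl = xyPow-on (suc c) 0 (suc j) refl
    ... | no j≢c = xyPow-off (suc c) 0 (suc j) (λ eq → j≢c (suc-injective eq))
    pascal : xyPow (suc c) ≈ ((xPow 1 ⊗ g) ⊕ (yPow 1 ⊗ g))
    pascal 0 0 = sym (∣⇒≡ₚ0 (∣m∣n⇒∣m+n (x-below 1 g 0 z<s) (y-below 1 g 0 z<s)))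
    pascal 0 (suc j) = trans (cong (_% p) (xyPow-bottom j))
      (sym (trans (%-remove-+ˡ _ (x-below 1 g (suc j) z<s)) (y-shift 1 g 0 j)))
    pascal (suc i) 0 = trans (cong (_% p) (xyPow-top i))
      (sym (trans (%-remove-+ʳ _ (y-below 1 g (suc i) z<s)) (x-shift 1 g i 0)))
    pascal (suc i) (suc j) = trans (cong (_% p) (xyPow-pascal c i j))
      (sym (+-congₚ {c = (yPow 1 ⊗ g) (suc i) (suc j)} (x-shift 1 g i (suc j)) (y-shift 1 g (suc i) j)))

  ≈0⇒p∣ : ∀ {f} → f ≈ zeroC → ∀ i j → p ∣ f i j
  ≈0⇒p∣ f≈0 i j = ≡ₚ-∣ (f≈0 i j) (p ∣0)

  p∣⇒≈0 : ∀ {f} → (∀ i j → p ∣ f i j) → f ≈ zeroC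
  p∣⇒≈0 z i j = ∣⇒≡ₚ0 (z i j)

  -- The coefficient of (x+y) f at x^i y^(j+1) is f(i,j) + f(i-1,j+1), without the second term when
  -- i = 0; so the rows of f vanish one after the other.
  xyPow-1-cancel : ∀ {f} → (xyPow 1 ⊗ f) ≈ zeroC → f ≈ zeroC
  xyPow-1-cancel {f} eq = p∣⇒≈0 z
    where
    sum0 : ∀ i j → p ∣ ((xPow 1 ⊗ f) ⊕ (yPow 1 ⊗ f)) i j
    sum0 i j = ≡ₚ-∣ (sym (xyPow-1-⊗ f i j)) (≈0⇒p∣ eq i j)
    z : ∀ i j → p ∣ f i j
    z zero j = ≡ₚ-∣ (sym (y-shift 1 f 0 j)) (∣m+n∣m⇒∣n (sum0 0 (suc j)) (x-below 1 f (suc j) z<s))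
    z (suc i) j = ≡ₚ-∣ (sym (y-shift 1 f (suc i) j))
      (∣m+n∣m⇒∣n (sum0 (suc i) (suc j)) (≡ₚ-∣ (x-shift 1 f i (suc j)) (z i (suc j))))

  xyPow-cancel : ∀ c {f} → (xyPow c ⊗ f) ≈ zeroC → f ≈ zeroC
  xyPow-cancel zero {f} eq = S.trans (S.sym (S.*-identityˡ f)) (S.trans (S.*-cong {S.1#} {xyPow 0} {f} (S.sym xyPow-0) S.refl) eq)
  xyPow-cancel (suc c) {f} eq = xyPow-cancel c (xyPow-1-cancel (S.trans (S.sym (S.*-assoc (xyPow 1) (xyPow c) f))
    (S.trans (S.*-cong {xyPow 1 ⊗ xyPow c} {xyPow (suc c)} {f} (S.sym (xyPow-suc c)) S.refl) eq)))

  xPow-cancel : ∀ a {f} → (xPow a ⊗ f) ≈ zeroC → f ≈ zeroC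
  xPow-cancel a {f} eq i j = trans (sym (x-shift a f i j)) (eq (a + i) j)

  yPow-cancel : ∀ b {f} → (yPow b ⊗ f) ≈ zeroC → f ≈ zeroC
  yPow-cancel b {f} eq i j = trans (sym (y-shift b f i j)) (eq i (b + j))

  -- Arrays with finite support and their lists of coefficients.

  Bounded : ℕ → Coeffs → Set
  Bounded N f = ∀ i j → N ≤ i ⊎ N ≤ j → p ∣ f i j

  Finite : Coeffs → Set
  Finite f = ∃[ N ] Bounded N f

  Bounded-mono : ∀ {M N f} → M ≤ N → Bounded M f → Bounded N f
  Bounded-mono M≤N b i j (inj₁ N≤i) = b i j (inj₁ (≤-trans M≤N N≤i))
  Bounded-mono M≤N b i j (inj₂ N≤j) = b i j (inj₂ (≤-trans M≤N N≤j))

  HomogOf⇒Finite : ∀ {d f} → HomogOf d f → Finite f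
  HomogOf⇒Finite {d} h = suc d , λ where
    i j (inj₁ d<i) → h i j (λ eq → <⇒≢ (<-≤-trans d<i (m≤m+n i j)) (sym eq))
    i j (inj₂ d<j) → h i j (λ eq → <⇒≢ (<-≤-trans d<j (m≤n+m j i)) (sym eq))

  Finite-⊕ : ∀ {f g} → Finite f → Finite g → Finite (f ⊕ g)
  Finite-⊕ {f} {g} (M , bf) (N , bg) = M + N , λ i j N≤ →
    ∣m∣n⇒∣m+n (Bounded-mono {f = f} (m≤m+n M N) bf i j N≤) (Bounded-mono {f = g} (m≤n+m N M) bg i j N≤)

  Finite-neg : ∀ {f} → Finite f → Finite (S.- f)
  Finite-neg (N , b) = N , λ i j N≤ → ∣n⇒∣m*n (pred p) (b i j N≤)

  Finite-⊗ : ∀ {f g} → Finite f → Finite g → Finite (f ⊗ g)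
  Finite-⊗ {f} {g} (M , bf) (N , bg) = M + N , λ i j big → ⊗-zero f g (λ a b a≤i b≤j → off big a≤i b≤j)
    where
    split : ∀ {i a} → M + N ≤ i → a ≤ i → M ≤ a ⊎ N ≤ i ∸ a
    split {i} {a} M+N≤i a≤i with M ≤? a
    ... | yes M≤a = inj₁ M≤a
    ... | no M≰a = inj₂ (m+n≤o⇒m≤o∸n N (≤-trans (+-monoʳ-≤ N (<⇒≤ (≰⇒> M≰a))) (≤-trans (≤-reflexive (+-comm N M)) M+N≤i)))
    off : ∀ {i j a b} → M + N ≤ i ⊎ M + N ≤ j → a ≤ i → b ≤ j → p ∣ f a b ⊎ p ∣ g (i ∸ a) (j ∸ b)
    off (inj₁ big) a≤i b≤j = [ (λ M≤a → inj₁ (bf _ _ (inj₁ M≤a))) , (λ N≤ → inj₂ (bg _ _ (inj₁ N≤))) ]′ (split big a≤i)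
    off (inj₂ big) a≤i b≤j = [ (λ M≤b → inj₁ (bf _ _ (inj₂ M≤b))) , (λ N≤ → inj₂ (bg _ _ (inj₂ N≤))) ]′ (split big b≤j)

  nth-beyond : ∀ as {j} → length as ≤ j → nth as j ≡ 0
  nth-beyond [] _ = refl
  nth-beyond (a ∷ as) (s≤s len≤j) = nth-beyond as len≤j

  Finite-⟦⟧ : ∀ f → Finite ⟦ f ⟧
  Finite-⟦⟧ [] = 0 , λ _ _ _ → p ∣0
  Finite-⟦⟧ (r ∷ rs) with Finite-⟦⟧ rs
  ... | N , b = suc (length r + N) , bounded
    where
    bounded : Bounded (suc (length r + N)) ⟦ r ∷ rs ⟧
    bounded zero j (inj₂ len<j) = ≡0⇒p∣ (nth-beyond r (≤-trans (m≤m+n (length r) N) (<⇒≤ len<j)))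
    bounded (suc i) j (inj₁ (s≤s N≤i)) = b i j (inj₁ (≤-trans (m≤n+m N (length r)) N≤i))
    bounded (suc i) j (inj₂ N<j) = b i j (inj₂ (≤-trans (m≤n+m N (length r)) (<⇒≤ N<j)))

  truncate : ℕ → Coeffs → Poly
  truncate N f = applyUpTo (λ i → applyUpTo (f i) N) N

  nth-applyUpTo : ∀ f N {j} → j < N → nth (applyUpTo f N) j ≡ f j
  nth-applyUpTo f (suc N) {zero} _ = refl
  nth-applyUpTo f (suc N) {suc j} (s≤s j<N) = nth-applyUpTo (λ k → f (suc k)) N j<N

  rowOf-applyUpTo : ∀ (f : ℕ → List ℕ) N {i} → i < N → rowOf (applyUpTo f N) i ≡ f i
  rowOf-applyUpTo f (suc N) {zero} _ = refl
  rowOf-applyUpTo f (suc N) {suc i} (s≤s i<N) = rowOf-applyUpTo (λ k → f (suc k)) N i<N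

  nth-applyUpTo-beyond : ∀ f N {j} → N ≤ j → nth (applyUpTo f N) j ≡ 0
  nth-applyUpTo-beyond f zero _ = refl
  nth-applyUpTo-beyond f (suc N) {suc j} (s≤s N≤j) = nth-applyUpTo-beyond (λ k → f (suc k)) N N≤j

  rowOf-applyUpTo-beyond : ∀ (f : ℕ → List ℕ) N {i} → N ≤ i → rowOf (applyUpTo f N) i ≡ []
  rowOf-applyUpTo-beyond f zero _ = refl
  rowOf-applyUpTo-beyond f (suc N) {suc i} (s≤s N≤i) = rowOf-applyUpTo-beyond (λ k → f (suc k)) N N≤i

  truncate-≈ : ∀ {N f} → Bounded N f → ⟦ truncate N f ⟧ ≈ f
  truncate-≈ {N} {f} b i j with i <? N
  ... | no i≮N = trans (cong (λ r → nth r j % p) (rowOf-applyUpTo-beyond _ N (≮⇒≥ i≮N))) (sym (∣⇒≡ₚ0 (b i j (inj₁ (≮⇒≥ i≮N)))))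
  ... | yes i<N with j <? N
  ...   | yes j<N = cong (_% p) (trans (cong (λ r → nth r j) (rowOf-applyUpTo _ N i<N)) (nth-applyUpTo (f i) N j<N))
  ...   | no j≮N = trans (cong (_% p) (trans (cong (λ r → nth r j) (rowOf-applyUpTo _ N i<N)) (nth-applyUpTo-beyond (f i) N (≮⇒≥ j≮N))))
                     (sym (∣⇒≡ₚ0 (b i j (inj₂ (≮⇒≥ j≮N)))))

  toPoly : ∀ {f} → Finite f → Poly
  toPoly {f} (N , _) = truncate N f

  toPoly-≈ : ∀ {f} (fin : Finite f) → ⟦ toPoly fin ⟧ ≈ f
  toPoly-≈ (N , b) = truncate-≈ b

-- Bounds on the exponents of D(A,ν).

∣m-n∣-bound-ordered : ∀ {L m n q} → L ≤ m → m ≤ n → m + n < L + L + q → ∣ m - n ∣ < q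
∣m-n∣-bound-ordered {L} {m} {n} {q} L≤m m≤n m+n< =
  subst (_< q) (sym (m≤n⇒∣m-n∣≡n∸m m≤n)) (+-cancelˡ-< (L + L) _ _ (begin-strict
  L + L + (n ∸ m)    ≡⟨ +-assoc L L (n ∸ m) ⟩
  L + (L + (n ∸ m))  ≤⟨ +-mono-≤ L≤m (+-monoˡ-≤ (n ∸ m) L≤m) ⟩
  m + (m + (n ∸ m))  ≡⟨ cong (m +_) (m+[n∸m]≡n m≤n) ⟩
  m + n              <⟨ m+n< ⟩
  L + L + q          ∎))
  where open ≤-Reasoning

∣m-n∣-bound : ∀ {L m n q} → L ≤ m → L ≤ n → m + n < L + L + q → ∣ m - n ∣ < q
∣m-n∣-bound {L} {m} {n} {q} L≤m L≤n m+n< with ≤-total m n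
... | inj₁ m≤n = ∣m-n∣-bound-ordered L≤m m≤n m+n<
... | inj₂ n≤m = subst (_< q) (∣-∣-comm n m) (∣m-n∣-bound-ordered L≤n n≤m (subst (_< L + L + q) (+-comm m n) m+n<))

module Derivations (p : ℕ) (pr : Prime p) where
  open Char p pr
  open BinomialMod p pr
  open Bivariate p pr

  θs : Der → Coeffs
  θs θ = θx θ ⊕ θy θ

  x∣-elim : ∀ {a f} → xPow a ∣ₛ f → ∀ {i} j → i < a → p ∣ f i j
  x∣-elim {a} (h , f≈) {i} j i<a = ≡ₚ-∣ (f≈ i j) (x-below a ⟦ h ⟧ j i<a)

  y∣-elim : ∀ {b f} → yPow b ∣ₛ f → ∀ i {j} → j < b → p ∣ f i j
  y∣-elim {b} (h , f≈) i {j} j<b = ≡ₚ-∣ (f≈ i j) (y-below b ⟦ h ⟧ i j<b)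

  x∣-intro : ∀ {a f} → Finite f → (∀ i j → i < a → p ∣ f i j) → xPow a ∣ₛ f
  x∣-intro {a} {f} (N , b) z = truncate N shifted , f≈
    where
    shifted : Coeffs
    shifted i j = f (a + i) j
    shifted-bounded : Bounded N shifted
    shifted-bounded i j (inj₁ N≤i) = b (a + i) j (inj₁ (≤-trans N≤i (m≤n+m i a)))
    shifted-bounded i j (inj₂ N≤j) = b (a + i) j (inj₂ N≤j)
    f≈ : f ≈ (xPow a ⊗ ⟦ truncate N shifted ⟧)
    f≈ i j with a ≤? i
    ... | no a≰i = ∣∣⇒≡ₚ (z i j (≰⇒> a≰i)) (x-below a ⟦ truncate N shifted ⟧ j (≰⇒> a≰i))
    ... | yes a≤i = subst (λ k → f k j ≡ₚ (xPow a ⊗ ⟦ truncate N shifted ⟧) k j) (m+[n∸m]≡n a≤i)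
      (sym (trans (x-shift a ⟦ truncate N shifted ⟧ (i ∸ a) j) (truncate-≈ shifted-bounded (i ∸ a) j)))

  y∣-intro : ∀ {c f} → Finite f → (∀ i j → j < c → p ∣ f i j) → yPow c ∣ₛ f
  y∣-intro {c} {f} (N , b) z = truncate N shifted , f≈
    where
    shifted : Coeffs
    shifted i j = f i (c + j)
    shifted-bounded : Bounded N shifted
    shifted-bounded i j (inj₁ N≤i) = b i (c + j) (inj₁ N≤i)
    shifted-bounded i j (inj₂ N≤j) = b i (c + j) (inj₂ (≤-trans N≤j (m≤n+m j c)))
    f≈ : f ≈ (yPow c ⊗ ⟦ truncate N shifted ⟧)
    f≈ i j with c ≤? j
    ... | no c≰j = ∣∣⇒≡ₚ (z i j (≰⇒> c≰j)) (y-below c ⟦ truncate N shifted ⟧ i (≰⇒> c≰j))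
    ... | yes c≤j = subst (λ k → f i k ≡ₚ (yPow c ⊗ ⟦ truncate N shifted ⟧) i k) (m+[n∸m]≡n c≤j)
      (sym (trans (y-shift c ⟦ truncate N shifted ⟧ i (j ∸ c)) (truncate-≈ shifted-bounded i (j ∸ c))))

  ∣ₛ-resp : ∀ {f g h} → g ≈ h → f ∣ₛ h → f ∣ₛ g
  ∣ₛ-resp g≈h (k , h≈) = k , λ i j → trans (g≈h i j) (h≈ i j)

  der : ∀ {u v} → Finite u → Finite v → Der
  der finu finv = toPoly finu , toPoly finv

  der-InD : ∀ a b c {u v w} (finu : Finite u) (finv : Finite v) → Finite w →
    (∀ i j → i < a → p ∣ u i j) → (∀ i j → j < b → p ∣ v i j) → (u ⊕ v) ≈ (xyPow c ⊗ w) →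
    InD (a , b , c) (der finu finv)
  der-InD a b c {u} {v} {w} finu finv finw x∣u y∣v u+v≈ =
      ∣ₛ-resp {xPow a} {⟦ toPoly finu ⟧} {u} (toPoly-≈ finu) (x∣-intro {a} {u} finu x∣u)
    , ∣ₛ-resp {yPow b} {⟦ toPoly finv ⟧} {v} (toPoly-≈ finv) (y∣-intro {b} {v} finv y∣v)
    , toPoly finw
    , S.trans (S.+-cong {⟦ toPoly finu ⟧} {u} {⟦ toPoly finv ⟧} {v} (toPoly-≈ finu) (toPoly-≈ finv))
        (S.trans u+v≈ (S.*-cong {xyPow c} {xyPow c} {w} {⟦ toPoly finw ⟧} (λ _ _ → refl) (S.sym (toPoly-≈ finw))))

  der-HomogDer : ∀ {d u v} (finu : Finite u) (finv : Finite v) → HomogOf d u → HomogOf d v → HomogDer d (der finu finv)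
  der-HomogDer finu finv hu hv =
    HomogOf⇒Homog (HomogOf-resp (toPoly-≈ finu) hu) , HomogOf⇒Homog (HomogOf-resp (toPoly-≈ finv) hv)

  -- The determinant of η₁, η₂ is the determinant of their coordinates times that of the basis,
  -- which has no terms below degree d₁ + d₂. Determinants use the values at x and x + y, and a
  -- nonzero coefficient is stated as two incongruent products because coefficients are natural
  -- numbers.
  exponents-≤ : ∀ {ν θ₁ d₁ θ₂ d₂ η₁ η₂} → HomBasis ν θ₁ d₁ θ₂ d₂ → InD ν η₁ → InD ν η₂ →
    ∀ i j → ¬ ((θx η₁ ⊗ θs η₂) i j ≡ₚ (θs η₁ ⊗ θx η₂) i j) → d₁ + d₂ ≤ i + j
  exponents-≤ {θ₁ = θ₁} {d₁} {θ₂} {d₂} {η₁} {η₂} (_ , _ , (hx₁ , hy₁) , (hx₂ , hy₂) , span , _) η₁∈ η₂∈ i j nondegenerate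
    with span η₁ η₁∈ | span η₂ η₂∈
  ... | F₁ , F₂ , x₁≈ , y₁≈ | G₁ , G₂ , x₂≈ , y₂≈ = ≮⇒≥ (λ i+j< → nondegenerate (det-equal i+j<))
    where
    a = θx θ₁
    b = θx θ₂
    c = θy θ₁
    d = θy θ₂
    f₁ = ⟦ F₁ ⟧
    f₂ = ⟦ F₂ ⟧
    g₁ = ⟦ G₁ ⟧
    g₂ = ⟦ G₂ ⟧
    X₁ = (f₁ ⊗ a) ⊕ (f₂ ⊗ b)
    Y₁ = (f₁ ⊗ c) ⊕ (f₂ ⊗ d)
    X₂ = (g₁ ⊗ a) ⊕ (g₂ ⊗ b)
    Y₂ = (g₁ ⊗ c) ⊕ (g₂ ⊗ d)
    s₁≈ : θs η₁ ≈ (X₁ ⊕ Y₁)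
    s₁≈ = S.+-cong {θx η₁} {X₁} {θy η₁} {Y₁} x₁≈ y₁≈
    s₂≈ : θs η₂ ≈ (X₂ ⊕ Y₂)
    s₂≈ = S.+-cong {θx η₂} {X₂} {θy η₂} {Y₂} x₂≈ y₂≈
    T₁ = a ⊗ (b ⊕ d)
    T₂ = (a ⊕ c) ⊗ b
    ord : ∀ {e f} → Homog e f → Order≥ e f
    ord h = HomogOf⇒Order≥ (Homog⇒HomogOf h)
    ordˢ : ∀ {e f g} → Homog e f → Homog e g → Order≥ e (f ⊕ g)
    ordˢ hf hg = HomogOf⇒Order≥ (HomogOf-⊕ (Homog⇒HomogOf hf) (Homog⇒HomogOf hg))
    high : ∀ f {T} → Order≥ (d₁ + d₂) T → Order≥ (d₁ + d₂) (f ⊗ T)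
    high f {T} = Order≥-⊗ 0 (d₁ + d₂) {f} {T} (λ _ _ ())
    T₁≥ : Order≥ (d₁ + d₂) T₁
    T₁≥ = Order≥-⊗ d₁ d₂ {a} {b ⊕ d} (ord {f = a} hx₁) (ordˢ {f = b} {d} hx₂ hy₂)
    T₂≥ : Order≥ (d₁ + d₂) T₂
    T₂≥ = Order≥-⊗ d₁ d₂ {a ⊕ c} {b} (ordˢ {f = a} {c} hx₁ hy₁) (ord {f = b} hx₂)
    -- The correction terms in `det-multiplicative` are multiples of `T₁` and `T₂`, so at this
    -- position they can be added on one side and dropped on the other.
    det-equal : i + j < d₁ + d₂ → (θx η₁ ⊗ θs η₂) i j ≡ₚ (θs η₁ ⊗ θx η₂) i j
    det-equal i+j< = begin
      (θx η₁ ⊗ θs η₂) i j % p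
        ≡⟨ S.*-cong {θx η₁} {X₁} {θs η₂} {X₂ ⊕ Y₂} x₁≈ s₂≈ i j ⟩
      (X₁ ⊗ (X₂ ⊕ Y₂)) i j % p
        ≡⟨ %-remove-+ʳ ((X₁ ⊗ (X₂ ⊕ Y₂)) i j) (∣m∣n⇒∣m+n (high (f₁ ⊗ g₂) {T₂} T₂≥ i j i+j<) (high (f₂ ⊗ g₁) {T₁} T₁≥ i j i+j<)) ⟨
      ((X₁ ⊗ (X₂ ⊕ Y₂)) ⊕ (((f₁ ⊗ g₂) ⊗ T₂) ⊕ ((f₂ ⊗ g₁) ⊗ T₁))) i j % p
        ≡⟨ RingIdentities.det-multiplicative 𝔽[[x,y]] a b c d f₁ f₂ g₁ g₂ i j ⟩
      (((X₁ ⊕ Y₁) ⊗ X₂) ⊕ (((f₁ ⊗ g₂) ⊗ T₁) ⊕ ((f₂ ⊗ g₁) ⊗ T₂))) i j % p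
        ≡⟨ %-remove-+ʳ (((X₁ ⊕ Y₁) ⊗ X₂) i j) (∣m∣n⇒∣m+n (high (f₁ ⊗ g₂) {T₁} T₁≥ i j i+j<) (high (f₂ ⊗ g₁) {T₂} T₂≥ i j i+j<)) ⟩
      ((X₁ ⊕ Y₁) ⊗ X₂) i j % p
        ≡⟨ S.*-cong {θs η₁} {X₁ ⊕ Y₁} {θx η₂} {X₂} s₁≈ x₂≈ i j ⟨
      (θs η₁ ⊗ θx η₂) i j % p ∎
      where open ≡-Reasoning

  Vanishes : Der → Set
  Vanishes θ = (θx θ ≈ zeroC) × (θy θ ≈ zeroC)

  -- The value at x + y is a multiple of (x+y)^c, hence zero for d < c and a scalar multiple of
  -- (x+y)^c for d = c. In the latter case x^i y^j with i < a and j < b occurs neither in θ(x) nor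
  -- in θ(y), which forces the scalar to be zero. Then θ(x) = - θ(y) is divisible by x^a and by y^b,
  -- too much for degree d < a + b.
  low-degree-vanishes : ∀ {a b c d θ} → InD (a , b , c) θ → HomogDer d θ → d ≤ c → d < a + b →
    (d ≡ c → ∃[ i ] ∃[ j ] (i < a × j < b × i + j ≡ c × ¬ p ∣ c C i)) → Vanishes θ
  low-degree-vanishes {a} {b} {c} {d} {θ} (x∣ , y∣ , h , s≈) (hx , hy) d≤c d<a+b obstruction =
    p∣⇒≈0 zx , p∣⇒≈0 zy
    where
    hx′ = Homog⇒HomogOf {f = θx θ} hx
    hy′ = Homog⇒HomogOf {f = θy θ} hy
    sum-on-degree : ∀ i j → i + j ≡ d → p ∣ θs θ i j
    sum-on-degree i j i+j≡d with m≤n⇒m<n∨m≡n d≤c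
    ... | inj₁ d<c = ≡ₚ-∣ (s≈ i j) (subst (λ e → Order≥ e (xyPow c ⊗ ⟦ h ⟧)) (+-identityʳ c)
      (Order≥-⊗ c 0 {xyPow c} {⟦ h ⟧} (HomogOf⇒Order≥ (xyPow-homog c)) (λ _ _ ())) i j (subst (_< c) (sym i+j≡d) d<c))
    ... | inj₂ d≡c with obstruction d≡c
    ...   | i₀ , j₀ , i₀<a , j₀<b , i₀+j₀≡c , p∤C =
      ≡ₚ-∣ (trans (s≈ i j) (xy-lead c ⟦ h ⟧ {i} {j} (trans i+j≡d d≡c))) (∣n⇒∣m*n (c C i) p∣h)
      where
      p∣C*h : p ∣ (c C i₀) * ⟦ h ⟧ 0 0
      p∣C*h = ≡ₚ-∣ (sym (trans (s≈ i₀ j₀) (xy-lead c ⟦ h ⟧ {i₀} {j₀} i₀+j₀≡c)))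
        (∣m∣n⇒∣m+n (x∣-elim {a} {θx θ} x∣ j₀ i₀<a) (y∣-elim {b} {θy θ} y∣ i₀ j₀<b))
      p∣h : p ∣ ⟦ h ⟧ 0 0
      p∣h = [ (λ p∣C → ⊥-elim (p∤C p∣C)) , (λ p∣h → p∣h) ]′ (euclidsLemma (c C i₀) (⟦ h ⟧ 0 0) pr p∣C*h)
    zx : ∀ i j → p ∣ θx θ i j
    zx i j with i + j ≟ d
    ... | no i+j≢d = hx′ i j i+j≢d
    ... | yes i+j≡d with i <? a
    ...   | yes i<a = x∣-elim {a} {θx θ} x∣ j i<a
    ...   | no i≮a = ∣m+n∣m⇒∣n (subst (p ∣_) (+-comm (θx θ i j) (θy θ i j)) (sum-on-degree i j i+j≡d)) (y∣-elim {b} {θy θ} y∣ i j<b)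
      where
      j<b : j < b
      j<b = +-cancelˡ-< a j b (≤-<-trans (+-monoˡ-≤ j (≮⇒≥ i≮a)) (subst (_< a + b) (sym i+j≡d) d<a+b))
    zy : ∀ i j → p ∣ θy θ i j
    zy i j with i + j ≟ d
    ... | no i+j≢d = hy′ i j i+j≢d
    ... | yes i+j≡d = ∣m+n∣m⇒∣n (sum-on-degree i j i+j≡d) (zx i j)

  basis-nonvanishing : ∀ {ν θ₁ d₁ θ₂ d₂} → HomBasis ν θ₁ d₁ θ₂ d₂ → ¬ Vanishes θ₁ × ¬ Vanishes θ₂
  basis-nonvanishing {θ₁ = θ₁} {θ₂ = θ₂} (_ , _ , _ , _ , _ , independent) =
      (λ (x≈0 , y≈0) → 1≉0 (proj₁ (independent one [] (onˡ {θx θ₁} {θx θ₂} x≈0) (onˡ {θy θ₁} {θy θ₂} y≈0))))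
    , (λ (x≈0 , y≈0) → 1≉0 (proj₂ (independent [] one (onʳ {θx θ₁} {θx θ₂} x≈0) (onʳ {θy θ₁} {θy θ₂} y≈0))))
    where
    one : Poly
    one = (1 ∷ []) ∷ []
    1≉0 : ¬ (⟦ one ⟧ ≈ zeroC)
    1≉0 eq = p∤1 (≈0⇒p∣ eq 0 0)
    ⊗0 : ∀ f {g} → g ≈ zeroC → (f ⊗ g) ≈ zeroC
    ⊗0 f {g} g≈0 = S.trans (S.*-cong {f} {f} {g} {zeroC} (λ _ _ → refl) g≈0) (S.zeroʳ f)
    onˡ : ∀ {u v} → u ≈ zeroC → ((⟦ one ⟧ ⊗ u) ⊕ (⟦ [] ⟧ ⊗ v)) ≈ zeroC
    onˡ {u} {v} u≈0 = S.trans (S.+-cong {⟦ one ⟧ ⊗ u} {zeroC} {⟦ [] ⟧ ⊗ v} {zeroC} (⊗0 ⟦ one ⟧ u≈0) (S.zeroˡ v)) (S.+-identityˡ zeroC)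
    onʳ : ∀ {u v} → v ≈ zeroC → ((⟦ [] ⟧ ⊗ u) ⊕ (⟦ one ⟧ ⊗ v)) ≈ zeroC
    onʳ {u} {v} v≈0 = S.trans (S.+-cong {⟦ [] ⟧ ⊗ u} {zeroC} {⟦ one ⟧ ⊗ v} {zeroC} (S.zeroˡ u) (⊗0 ⟦ one ⟧ v≈0)) (S.+-identityˡ zeroC)

  -- Two elements of D(A,ν) whose determinant is nonzero and homogeneous of degree |ν|;
  -- the determinant is recorded through its coefficient at x^i y^j.
  NondegeneratePair : Mult → Set
  NondegeneratePair ν = ∃[ η₁ ] ∃[ η₂ ] ∃[ i ] ∃[ j ]
    ( InD ν η₁ × InD ν η₂ × i + j ≡ ∣ ν ∣ₘ × ¬ ((θx η₁ ⊗ θs η₂) i j ≡ₚ (θs η₁ ⊗ θx η₂) i j))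

  Δ-bound : ∀ {ν q} L → (∀ θ d → InD ν θ → HomogDer d θ → d < L → Vanishes θ) →
    NondegeneratePair ν → ∣ ν ∣ₘ < L + L + q → ∀ δ → HasΔ ν δ → δ < q
  Δ-bound {ν} {q} L low (η₁ , η₂ , i , j , η₁∈ , η₂∈ , i+j≡ , nondegenerate) ∣ν∣<
    δ (θ₁ , d₁ , θ₂ , d₂ , basis@(θ₁∈ , θ₂∈ , h₁ , h₂ , _) , δ≡) =
    subst (_< q) (sym δ≡) (∣m-n∣-bound
      (≮⇒≥ (λ d₁<L → proj₁ (basis-nonvanishing {ν} {θ₁} {d₁} {θ₂} {d₂} basis) (low θ₁ d₁ θ₁∈ h₁ d₁<L)))
      (≮⇒≥ (λ d₂<L → proj₂ (basis-nonvanishing {ν} {θ₁} {d₁} {θ₂} {d₂} basis) (low θ₂ d₂ θ₂∈ h₂ d₂<L)))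
      (≤-<-trans (exponents-≤ {ν} {θ₁} {d₁} {θ₂} {d₂} {η₁} {η₂} basis η₁∈ η₂∈ i j nondegenerate) (subst (_< L + L + q) (sym i+j≡) ∣ν∣<)))

  -- Derivations obtained by cutting a form at an x-degree.

  -- For a form without monomials x^i y^j with i < a and j < b, this cut is a decomposition x^a A +
  -- y^b B.
  hi lo : ℕ → Coeffs → Coeffs
  hi a s i j with a ≤? i
  ... | yes _ = s i j
  ... | no _ = 0
  lo a s i j with a ≤? i
  ... | yes _ = 0
  ... | no _ = s i j

  hi+lo : ∀ a s → (hi a s ⊕ lo a s) ≈ s
  hi+lo a s i j with a ≤? i
  ... | yes _ = cong (_% p) (+-identityʳ (s i j))
  ... | no _ = refl

  hi-homog : ∀ {d} a s → HomogOf d s → HomogOf d (hi a s)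
  hi-homog a s h i j i+j≢d with a ≤? i
  ... | yes _ = h i j i+j≢d
  ... | no _ = p ∣0

  lo-homog : ∀ {d} a s → HomogOf d s → HomogOf d (lo a s)
  lo-homog a s h i j i+j≢d with a ≤? i
  ... | yes _ = p ∣0
  ... | no _ = h i j i+j≢d

  hi-below : ∀ a s i j → i < a → p ∣ hi a s i j
  hi-below a s i j i<a with a ≤? i
  ... | yes a≤i = ⊥-elim (<⇒≱ i<a a≤i)
  ... | no _ = p ∣0

  lo-below : ∀ {d} a b s → HomogOf d s → (∀ i j → i + j ≡ d → i < a → j < b → p ∣ s i j) →
    ∀ i j → j < b → p ∣ lo a s i j
  lo-below {d} a b s h gap i j j<b with a ≤? i
  ... | yes _ = p ∣0
  ... | no a≰i with i + j ≟ d
  ...   | yes i+j≡d = gap i j i+j≡d (≰⇒> a≰i) j<b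
  ...   | no i+j≢d = h i j i+j≢d

  -- At x-degree `a` only the lowest row of `hi a s` contributes, and homogeneity leaves the single
  -- monomial x^a y^k in that row.
  hi-lead : ∀ {a k j} s t → HomogOf (a + k) s → k ≤ j → (hi a s ⊗ t) a j ≡ₚ s a k * t 0 (j ∸ k)
  hi-lead {a} {k} {j} s t h k≤j = trans (⊗-single (hi a s) t {a} {j} {a} {k} ≤-refl k≤j on)
    (cong (_% p) (cong₂ _*_ at (cong (λ z → t z (j ∸ k)) (n∸n≡0 a))))
    where
    at : hi a s a k ≡ s a k
    at with a ≤? a
    ... | yes _ = refl
    ... | no a≰a = ⊥-elim (a≰a ≤-refl)
    on : ∀ i l → i ≤ a → l ≤ j → p ∣ hi a s i l ⊎ (i ≡ a × l ≡ k)
    on i l i≤a _ with a ≤? i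
    ... | no _ = inj₁ (p ∣0)
    ... | yes a≤i with l ≟ k
    ...   | yes l≡k = inj₂ (≤-antisym i≤a a≤i , l≡k)
    ...   | no l≢k = inj₁ (h i l (λ eq → l≢k (+-cancelˡ-≡ a l k (trans (cong (_+ l) (≤-antisym a≤i i≤a)) eq))))

  -- The derivation whose value on x + y is s = (x+y)^c w, obtained by splitting s at x-degree a.
  module Split (a b c n : ℕ) {w : Coeffs} (hw : HomogOf n w)
    (gap : ∀ i j → i + j ≡ c + n → i < a → j < b → p ∣ (xyPow c ⊗ w) i j) where

    s = xyPow c ⊗ w

    s-homog : HomogOf (c + n) s
    s-homog = HomogOf-⊗ {f = xyPow c} {w} (xyPow-homog c) hw

    hi-fin = HomogOf⇒Finite (hi-homog a s s-homog)
    lo-fin = HomogOf⇒Finite (lo-homog a s s-homog)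

    θ : Der
    θ = der hi-fin lo-fin

    θ∈D : InD (a , b , c) θ
    θ∈D = der-InD a b c hi-fin lo-fin (HomogOf⇒Finite hw) (hi-below a s) (lo-below a b s s-homog gap) (hi+lo a s)

    θ-homog : HomogDer (c + n) θ
    θ-homog = der-HomogDer hi-fin lo-fin (hi-homog a s s-homog) (lo-homog a s s-homog)

    θx≈ : θx θ ≈ hi a s
    θx≈ = toPoly-≈ hi-fin

    θs≈ : θs θ ≈ s
    θs≈ = S.trans (S.+-cong {θx θ} {hi a s} {θy θ} {lo a s} θx≈ (toPoly-≈ lo-fin)) (hi+lo a s)

  -- The degrees c + n₁ and c + n₂ add up to |ν|. Both products in the determinant are divisible by
  -- x^a, so it is tested at x^a y^(b+c), the lowest x-degree available; there each product reduces
  -- to the coefficient of x^a in one form times that of the pure power of y in the other.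
  split-pair : ∀ a b c n₁ n₂ k₁ k₂ {w₁ w₂} → HomogOf n₁ w₁ → HomogOf n₂ w₂ →
    (∀ i j → i + j ≡ c + n₁ → i < a → j < b → p ∣ (xyPow c ⊗ w₁) i j) →
    (∀ i j → i + j ≡ c + n₂ → i < a → j < b → p ∣ (xyPow c ⊗ w₂) i j) →
    a + k₁ ≡ c + n₁ → a + k₂ ≡ c + n₂ → c + n₁ + n₂ ≡ a + b →
    ¬ ((xyPow c ⊗ w₁) a k₁ * (xyPow c ⊗ w₂) 0 (c + n₂) ≡ₚ (xyPow c ⊗ w₂) a k₂ * (xyPow c ⊗ w₁) 0 (c + n₁)) →
    NondegeneratePair (a , b , c)
  split-pair a b c n₁ n₂ k₁ k₂ {w₁} {w₂} hw₁ hw₂ gap₁ gap₂ e₁ e₂ total nondegenerate =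
    S₁.θ , S₂.θ , a , b + c , S₁.θ∈D , S₂.θ∈D , sym (+-assoc a b c) ,
    λ eq → nondegenerate (trans (sym det₁) (trans eq det₂))
    where
    module S₁ = Split a b c n₁ {w₁} hw₁ gap₁
    module S₂ = Split a b c n₂ {w₂} hw₂ gap₂
    rest : ∀ {k n n′} → a + k ≡ c + n → c + n + n′ ≡ a + b → k + (c + n′) ≡ b + c
    rest {k} {n} {n′} e t = +-cancelˡ-≡ a _ _ (begin
      a + (k + (c + n′))   ≡⟨ +-assoc a k (c + n′) ⟨
      a + k + (c + n′)     ≡⟨ cong (_+ (c + n′)) e ⟩
      c + n + (c + n′)     ≡⟨ shuffle c n n′ ⟩
      c + n + n′ + c       ≡⟨ cong (_+ c) t ⟩
      a + b + c            ≡⟨ +-assoc a b c ⟩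
      a + (b + c)          ∎)
      where
      open ≡-Reasoning
      shuffle : ∀ c n n′ → c + n + (c + n′) ≡ c + n + n′ + c
      shuffle = ℕ-Solver.solve-∀
    lead : ∀ {k e} s t → HomogOf (a + k) s → k + e ≡ b + c → (hi a s ⊗ t) a (b + c) ≡ₚ s a k * t 0 e
    lead {k} {e} s t h k+e≡ = trans (hi-lead s t h (≤-trans (m≤m+n k e) (≤-reflexive k+e≡)))
      (cong (λ z → (s a k * t 0 z) % p) (trans (cong (_∸ k) (sym k+e≡)) (m+n∸m≡n k e)))
    det₁ : (θx S₁.θ ⊗ θs S₂.θ) a (b + c) ≡ₚ S₁.s a k₁ * S₂.s 0 (c + n₂)
    det₁ = trans (S.*-cong {θx S₁.θ} {hi a S₁.s} {θs S₂.θ} {S₂.s} S₁.θx≈ S₂.θs≈ a (b + c))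
      (lead S₁.s S₂.s (subst (λ d → HomogOf d S₁.s) (sym e₁) S₁.s-homog) (rest e₁ total))
    det₂ : (θs S₁.θ ⊗ θx S₂.θ) a (b + c) ≡ₚ S₂.s a k₂ * S₁.s 0 (c + n₁)
    det₂ = trans (S.*-cong {θs S₁.θ} {S₁.s} {θx S₂.θ} {hi a S₂.s} S₁.θs≈ S₂.θx≈ a (b + c))
      (trans (S.*-comm S₁.s (hi a S₂.s) a (b + c))
        (lead S₂.s S₁.s (subst (λ d → HomogOf d S₂.s) (sym e₂) S₂.s-homog)
          (rest e₂ (trans (shuffle c n₂ n₁) total))))
      where
      shuffle : ∀ c n₂ n₁ → c + n₂ + n₁ ≡ c + n₁ + n₂
      shuffle = ℕ-Solver.solve-∀

  1-homog : HomogOf 0 S.1#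
  1-homog zero zero i+j≢0 = ⊥-elim (i+j≢0 refl)
  1-homog zero (suc j) _ = p ∣0
  1-homog (suc i) j _ = p ∣0

  ⊗1 : ∀ f → (f ⊗ S.1#) ≈ f
  ⊗1 = S.*-identityʳ

  -- When (x+y)^c ∈ (x^a , y^b), i.e. (x+y)^c = x^a A + y^b B, the derivations (x^a A , y^b B)
  -- and (x^a y^b , - x^a y^b) form a basis of D(A,(a,b,c)).
  module SplitBasis (a b c : ℕ) (gap : ∀ i j → i + j ≡ c → i < a → j < b → p ∣ c C i) where

    module S₁ = Split a b c 0 {S.1#} 1-homog
      (λ i j i+j≡ i<a j<b → ≡ₚ-∣ (⊗1 (xyPow c) i j)
        (subst (p ∣_) (sym (xyPow-on c i j (trans i+j≡ (+-identityʳ c)))) (gap i j (trans i+j≡ (+-identityʳ c)) i<a j<b)))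

    θ₁ = S₁.θ

    s₁≈ : θs θ₁ ≈ xyPow c
    s₁≈ = S.trans S₁.θs≈ (⊗1 (xyPow c))

    θ₁-homog : HomogDer c θ₁
    θ₁-homog = subst (λ d → HomogDer d θ₁) (+-identityʳ c) S₁.θ-homog

    K = xPow a ⊗ yPow b

    K-homog : HomogOf (a + b) K
    K-homog = HomogOf-⊗ {f = xPow a} {yPow b} (xPow-homog a) (yPow-homog b)

    -K-homog : HomogOf (a + b) (S.- K)
    -K-homog i j i+j≢ = ∣n⇒∣m*n (pred p) (K-homog i j i+j≢)

    K-fin = HomogOf⇒Finite K-homog
    -K-fin = HomogOf⇒Finite -K-homog

    K-y-below : ∀ i j → j < b → p ∣ K i j
    K-y-below i j j<b = ≡ₚ-∣ (S.*-comm (xPow a) (yPow b) i j) (y-below b (xPow a) i j<b)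

    θ₂ : Der
    θ₂ = der K-fin -K-fin

    K+-K≈0 : (K ⊕ (S.- K)) ≈ zeroC
    K+-K≈0 = S.-‿inverseʳ K

    θ₂∈D : InD (a , b , c) θ₂
    θ₂∈D = der-InD a b c {w = zeroC} K-fin -K-fin (0 , λ _ _ _ → p ∣0) (λ i j i<a → x-below a (yPow b) j i<a)
      (λ i j j<b → ∣n⇒∣m*n (pred p) (K-y-below i j j<b)) (S.trans K+-K≈0 (S.sym (S.zeroʳ (xyPow c))))

    θ₂-homog : HomogDer (a + b) θ₂
    θ₂-homog = der-HomogDer K-fin -K-fin K-homog -K-homog

    s₂≈ : θs θ₂ ≈ zeroC
    s₂≈ = S.trans (S.+-cong {θx θ₂} {K} {θy θ₂} {S.- K} (toPoly-≈ K-fin) (toPoly-≈ -K-fin)) K+-K≈0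

    -- As `θ₂` kills x + y, the determinant is up to sign x^a y^b (x+y)^c, with coefficient 1 at x^a
    -- y^(b+c).
    pair : NondegeneratePair (a , b , c)
    pair = θ₁ , θ₂ , a , b + c , S₁.θ∈D , θ₂∈D , sym (+-assoc a b c) ,
      λ eq → p∤1 (≡ₚ-∣ (trans (sym det₂) (trans (sym eq) det₁)) (p ∣0))
      where
      det₁ : (θx θ₁ ⊗ θs θ₂) a (b + c) ≡ₚ 0
      det₁ = S.trans (S.*-cong {θx θ₁} {θx θ₁} {θs θ₂} {zeroC} S.refl s₂≈) (S.zeroʳ (θx θ₁)) a (b + c)
      det₂ : (θs θ₁ ⊗ θx θ₂) a (b + c) ≡ₚ 1
      det₂ = begin
        (θs θ₁ ⊗ θx θ₂) a (b + c) % p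
          ≡⟨ S.*-cong {θs θ₁} {xyPow c} {θx θ₂} {K} s₁≈ (toPoly-≈ K-fin) a (b + c) ⟩
        (xyPow c ⊗ K) a (b + c) % p
          ≡⟨ S.*-comm (xyPow c) K a (b + c) ⟩
        (K ⊗ xyPow c) a (b + c) % p
          ≡⟨ S.*-assoc (xPow a) (yPow b) (xyPow c) a (b + c) ⟩
        (xPow a ⊗ (yPow b ⊗ xyPow c)) a (b + c) % p
          ≡⟨ cong (λ z → (xPow a ⊗ (yPow b ⊗ xyPow c)) z (b + c) % p) (+-identityʳ a) ⟨
        (xPow a ⊗ (yPow b ⊗ xyPow c)) (a + 0) (b + c) % p
          ≡⟨ x-shift a (yPow b ⊗ xyPow c) 0 (b + c) ⟩
        (yPow b ⊗ xyPow c) 0 (b + c) % p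
          ≡⟨ y-shift b (xyPow c) 0 c ⟩
        xyPow c 0 c % p
          ≡⟨ cong (_% p) (xyPow-on c 0 c refl) ⟩
        1 % p ∎
        where open ≡-Reasoning

    -- If θ(x+y) = (x+y)^c h, then θ - h θ₁ kills x + y. Its values `Rx` and `Ry` are opposite, so
    -- `Rx` is divisible by y^b as well as by x^a, and θ - h θ₁ is a multiple of θ₂.
    spanning : ∀ θ → InD (a , b , c) θ → ∃[ f₁ ] ∃[ f₂ ]
      ( (θx θ ≈ ((⟦ f₁ ⟧ ⊗ θx θ₁) ⊕ (⟦ f₂ ⟧ ⊗ θx θ₂)))
      × (θy θ ≈ ((⟦ f₁ ⟧ ⊗ θy θ₁) ⊕ (⟦ f₂ ⟧ ⊗ θy θ₂))))
    spanning θ (x∣ , y∣ , H , s≈) = H , f₂ , x-eq , y-eq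
      where
      open import Algebra.Properties.Ring S.ring using (-‿distribʳ-*)
      open import Algebra.Properties.AbelianGroup S.+-abelianGroup using (⁻¹-∙-comm; inverseˡ-unique)
      open SetoidReasoning S.setoid
      h = ⟦ H ⟧
      X = θx θ
      Y = θy θ
      A = θx θ₁
      B = θy θ₁
      Rx = X ⊕ (S.- (h ⊗ A))
      Ry = Y ⊕ (S.- (h ⊗ B))
      restore : ∀ u v → u ≈ (v ⊕ (u ⊕ (S.- v)))
      restore u v = S.sym (begin
        v ⊕ (u ⊕ (S.- v))  ≈⟨ S.+-comm v (u ⊕ (S.- v)) ⟩
        (u ⊕ (S.- v)) ⊕ v  ≈⟨ S.+-assoc u (S.- v) v ⟩
        u ⊕ ((S.- v) ⊕ v)  ≈⟨ S.+-cong {u} {u} {(S.- v) ⊕ v} {zeroC} S.refl (S.-‿inverseˡ v) ⟩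
        u ⊕ zeroC          ≈⟨ S.+-identityʳ u ⟩
        u                  ∎)
      Rx+Ry≈0 : (Rx ⊕ Ry) ≈ zeroC
      Rx+Ry≈0 = begin
        Rx ⊕ Ry
          ≈⟨ interchange X (S.- (h ⊗ A)) Y (S.- (h ⊗ B)) ⟩
        (X ⊕ Y) ⊕ ((S.- (h ⊗ A)) ⊕ (S.- (h ⊗ B)))
          ≈⟨ S.+-cong {X ⊕ Y} {xyPow c ⊗ h} {(S.- (h ⊗ A)) ⊕ (S.- (h ⊗ B))} {S.- (xyPow c ⊗ h)} s≈ (begin
              (S.- (h ⊗ A)) ⊕ (S.- (h ⊗ B))  ≈⟨ ⁻¹-∙-comm (h ⊗ A) (h ⊗ B) ⟩
              S.- ((h ⊗ A) ⊕ (h ⊗ B))        ≈⟨ S.-‿cong (S.distribˡ h A B) ⟨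
              S.- (h ⊗ (A ⊕ B))              ≈⟨ S.-‿cong (S.*-cong {h} {h} {A ⊕ B} {xyPow c} S.refl s₁≈) ⟩
              S.- (h ⊗ xyPow c)              ≈⟨ S.-‿cong (S.*-comm h (xyPow c)) ⟩
              S.- (xyPow c ⊗ h)              ∎) ⟩
        (xyPow c ⊗ h) ⊕ (S.- (xyPow c ⊗ h))
          ≈⟨ S.-‿inverseʳ (xyPow c ⊗ h) ⟩
        zeroC ∎
        where open import Algebra.Properties.CommutativeSemigroup S.+-commutativeSemigroup using (interchange)
      Rx-fin : Finite Rx
      Rx-fin = Finite-⊕ {X} {S.- (h ⊗ A)} (Finite-⟦⟧ (proj₁ θ)) (Finite-neg {h ⊗ A} (Finite-⊗ {h} {A} (Finite-⟦⟧ H) (Finite-⟦⟧ (proj₁ θ₁))))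
      Rx-x : ∀ i j → i < a → p ∣ Rx i j
      Rx-x i j i<a = ∣m∣n⇒∣m+n (x∣-elim {a} {X} x∣ j i<a) (∣n⇒∣m*n (pred p)
        (⊗-zero h A (λ k l k≤i _ → inj₂ (x∣-elim {a} {A} (proj₁ S₁.θ∈D) (j ∸ l) (≤-<-trans (m∸n≤m i k) i<a)))))
      Ry-y : ∀ i j → j < b → p ∣ Ry i j
      Ry-y i j j<b = ∣m∣n⇒∣m+n (y∣-elim {b} {Y} y∣ i j<b) (∣n⇒∣m*n (pred p)
        (⊗-zero h B (λ k l _ l≤j → inj₂ (y∣-elim {b} {B} (proj₁ (proj₂ S₁.θ∈D)) (i ∸ k) (≤-<-trans (m∸n≤m j l) j<b)))))
      Rx-y : ∀ i j → j < b → p ∣ Rx i j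
      Rx-y i j j<b = ∣m+n∣m⇒∣n (subst (p ∣_) (+-comm (Rx i j) (Ry i j)) (≈0⇒p∣ Rx+Ry≈0 i j)) (Ry-y i j j<b)
      x-quotient : xPow a ∣ₛ Rx
      x-quotient = x∣-intro Rx-fin Rx-x
      R′ = proj₁ x-quotient
      y-quotient : yPow b ∣ₛ ⟦ R′ ⟧
      y-quotient = y∣-intro (Finite-⟦⟧ R′) (λ i j j<b →
        ≡ₚ-∣ (trans (sym (x-shift a ⟦ R′ ⟧ i j)) (sym (proj₂ x-quotient (a + i) j))) (Rx-y (a + i) j j<b))
      f₂ = proj₁ y-quotient
      Rx≈ : Rx ≈ (⟦ f₂ ⟧ ⊗ K)
      Rx≈ = begin
        Rx                            ≈⟨ proj₂ x-quotient ⟩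
        xPow a ⊗ ⟦ R′ ⟧               ≈⟨ S.*-cong {xPow a} {xPow a} {⟦ R′ ⟧} {yPow b ⊗ ⟦ f₂ ⟧} S.refl (proj₂ y-quotient) ⟩
        xPow a ⊗ (yPow b ⊗ ⟦ f₂ ⟧)    ≈⟨ S.*-assoc (xPow a) (yPow b) ⟦ f₂ ⟧ ⟨
        K ⊗ ⟦ f₂ ⟧                    ≈⟨ S.*-comm K ⟦ f₂ ⟧ ⟩
        ⟦ f₂ ⟧ ⊗ K                    ∎
      Ry≈ : Ry ≈ (⟦ f₂ ⟧ ⊗ (S.- K))
      Ry≈ = begin
        Ry                  ≈⟨ inverseˡ-unique Ry Rx (S.trans (S.+-comm Ry Rx) Rx+Ry≈0) ⟩
        S.- Rx              ≈⟨ S.-‿cong Rx≈ ⟩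
        S.- (⟦ f₂ ⟧ ⊗ K)    ≈⟨ -‿distribʳ-* ⟦ f₂ ⟧ K ⟩
        ⟦ f₂ ⟧ ⊗ (S.- K)    ∎
      x-eq : X ≈ ((h ⊗ A) ⊕ (⟦ f₂ ⟧ ⊗ θx θ₂))
      x-eq = begin
        X                                ≈⟨ restore X (h ⊗ A) ⟩
        (h ⊗ A) ⊕ Rx                     ≈⟨ S.+-cong {h ⊗ A} {h ⊗ A} {Rx} {⟦ f₂ ⟧ ⊗ K} S.refl Rx≈ ⟩
        (h ⊗ A) ⊕ (⟦ f₂ ⟧ ⊗ K)           ≈⟨ S.+-cong {h ⊗ A} {h ⊗ A} {⟦ f₂ ⟧ ⊗ K} {⟦ f₂ ⟧ ⊗ θx θ₂} S.refl
                                              (S.*-cong {⟦ f₂ ⟧} {⟦ f₂ ⟧} {K} {θx θ₂} S.refl (S.sym (toPoly-≈ K-fin))) ⟩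
        (h ⊗ A) ⊕ (⟦ f₂ ⟧ ⊗ θx θ₂)       ∎
      y-eq : Y ≈ ((h ⊗ B) ⊕ (⟦ f₂ ⟧ ⊗ θy θ₂))
      y-eq = begin
        Y                                ≈⟨ restore Y (h ⊗ B) ⟩
        (h ⊗ B) ⊕ Ry                     ≈⟨ S.+-cong {h ⊗ B} {h ⊗ B} {Ry} {⟦ f₂ ⟧ ⊗ (S.- K)} S.refl Ry≈ ⟩
        (h ⊗ B) ⊕ (⟦ f₂ ⟧ ⊗ (S.- K))     ≈⟨ S.+-cong {h ⊗ B} {h ⊗ B} {⟦ f₂ ⟧ ⊗ (S.- K)} {⟦ f₂ ⟧ ⊗ θy θ₂} S.refl
                                              (S.*-cong {⟦ f₂ ⟧} {⟦ f₂ ⟧} {S.- K} {θy θ₂} S.refl (S.sym (toPoly-≈ -K-fin))) ⟩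
        (h ⊗ B) ⊕ (⟦ f₂ ⟧ ⊗ θy θ₂)       ∎

    -- The two relations add up to the relation at x + y, where θ₂ vanishes; this leaves f₁ (x+y)^c
    -- = 0. The relation at x then reads f₂ x^a y^b = 0.
    independent : ∀ f₁ f₂ →
      (((⟦ f₁ ⟧ ⊗ θx θ₁) ⊕ (⟦ f₂ ⟧ ⊗ θx θ₂)) ≈ zeroC) →
      (((⟦ f₁ ⟧ ⊗ θy θ₁) ⊕ (⟦ f₂ ⟧ ⊗ θy θ₂)) ≈ zeroC) →
      (⟦ f₁ ⟧ ≈ zeroC) × (⟦ f₂ ⟧ ≈ zeroC)
    independent F₁ F₂ x≈0 y≈0 = f₁≈0 , f₂≈0
      where
      open SetoidReasoning S.setoid
      f₁ = ⟦ F₁ ⟧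
      f₂ = ⟦ F₂ ⟧
      f₁≈0 : f₁ ≈ zeroC
      f₁≈0 = xyPow-cancel c (begin
        xyPow c ⊗ f₁
          ≈⟨ S.*-comm (xyPow c) f₁ ⟩
        f₁ ⊗ xyPow c
          ≈⟨ S.*-cong {f₁} {f₁} {θs θ₁} {xyPow c} S.refl s₁≈ ⟨
        f₁ ⊗ θs θ₁
          ≈⟨ S.+-identityʳ (f₁ ⊗ θs θ₁) ⟨
        (f₁ ⊗ θs θ₁) ⊕ zeroC
          ≈⟨ S.+-cong {f₁ ⊗ θs θ₁} {f₁ ⊗ θs θ₁} {f₂ ⊗ θs θ₂} {zeroC} S.refl
               (S.trans (S.*-cong {f₂} {f₂} {θs θ₂} {zeroC} S.refl s₂≈) (S.zeroʳ f₂)) ⟨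
        (f₁ ⊗ θs θ₁) ⊕ (f₂ ⊗ θs θ₂)
          ≈⟨ S.+-cong {f₁ ⊗ θs θ₁} {(f₁ ⊗ θx θ₁) ⊕ (f₁ ⊗ θy θ₁)} {f₂ ⊗ θs θ₂} {(f₂ ⊗ θx θ₂) ⊕ (f₂ ⊗ θy θ₂)}
               (S.distribˡ f₁ (θx θ₁) (θy θ₁)) (S.distribˡ f₂ (θx θ₂) (θy θ₂)) ⟩
        ((f₁ ⊗ θx θ₁) ⊕ (f₁ ⊗ θy θ₁)) ⊕ ((f₂ ⊗ θx θ₂) ⊕ (f₂ ⊗ θy θ₂))
          ≈⟨ interchange (f₁ ⊗ θx θ₁) (f₁ ⊗ θy θ₁) (f₂ ⊗ θx θ₂) (f₂ ⊗ θy θ₂) ⟩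
        ((f₁ ⊗ θx θ₁) ⊕ (f₂ ⊗ θx θ₂)) ⊕ ((f₁ ⊗ θy θ₁) ⊕ (f₂ ⊗ θy θ₂))
          ≈⟨ S.+-cong {(f₁ ⊗ θx θ₁) ⊕ (f₂ ⊗ θx θ₂)} {zeroC} {(f₁ ⊗ θy θ₁) ⊕ (f₂ ⊗ θy θ₂)} {zeroC} x≈0 y≈0 ⟩
        zeroC ⊕ zeroC
          ≈⟨ S.+-identityˡ zeroC ⟩
        zeroC ∎)
        where open import Algebra.Properties.CommutativeSemigroup S.+-commutativeSemigroup using (interchange)
      f₂≈0 : f₂ ≈ zeroC
      f₂≈0 = yPow-cancel b (xPow-cancel a (begin
        xPow a ⊗ (yPow b ⊗ f₂)         ≈⟨ S.*-assoc (xPow a) (yPow b) f₂ ⟨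
        K ⊗ f₂                         ≈⟨ S.*-comm K f₂ ⟩
        f₂ ⊗ K                         ≈⟨ S.*-cong {f₂} {f₂} {θx θ₂} {K} S.refl (toPoly-≈ K-fin) ⟨
        f₂ ⊗ θx θ₂                     ≈⟨ S.+-identityˡ (f₂ ⊗ θx θ₂) ⟨
        zeroC ⊕ (f₂ ⊗ θx θ₂)           ≈⟨ S.+-cong {f₁ ⊗ θx θ₁} {zeroC} {f₂ ⊗ θx θ₂} {f₂ ⊗ θx θ₂}
                                            (S.trans (S.*-cong {f₁} {zeroC} {θx θ₁} {θx θ₁} f₁≈0 S.refl) (S.zeroˡ (θx θ₁))) S.refl ⟨
        (f₁ ⊗ θx θ₁) ⊕ (f₂ ⊗ θx θ₂)    ≈⟨ x≈0 ⟩
        zeroC                          ∎))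

    basis : HomBasis (a , b , c) θ₁ c θ₂ (a + b)
    basis = S₁.θ∈D , θ₂∈D , θ₁-homog , θ₂-homog , spanning , independent

-- The centre and its six neighbours.

module Neighbours (p : ℕ) (pr : Prime p) where
  open Char p pr
  open BinomialMod p pr
  open Bivariate p pr
  open Derivations p pr

  xy⊗x-shift : ∀ c k i j → (xyPow c ⊗ xPow k) (k + i) j ≡ₚ xyPow c i j
  xy⊗x-shift c k i j = trans (S.*-comm (xyPow c) (xPow k) (k + i) j) (x-shift k (xyPow c) i j)

  xy⊗y-shift : ∀ c k i j → (xyPow c ⊗ yPow k) i (k + j) ≡ₚ xyPow c i j
  xy⊗y-shift c k i j = trans (S.*-comm (xyPow c) (yPow k) i (k + j)) (y-shift k (xyPow c) i j)

  xy⊗x-below : ∀ c k {i} j → i < k → p ∣ (xyPow c ⊗ xPow k) i j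
  xy⊗x-below c k {i} j i<k = ≡ₚ-∣ (S.*-comm (xyPow c) (xPow k) i j) (x-below k (xyPow c) j i<k)

  xy⊗y-below : ∀ c k i {j} → j < k → p ∣ (xyPow c ⊗ yPow k) i j
  xy⊗y-below c k i {j} j<k = ≡ₚ-∣ (S.*-comm (xyPow c) (yPow k) i j) (y-below k (xyPow c) i j<k)

  xy⊗xy : ∀ c → (xyPow c ⊗ xyPow 1) ≈ xyPow (suc c)
  xy⊗xy c = S.trans (S.*-comm (xyPow c) (xyPow 1)) (S.sym (xyPow-suc c))

  +-cancelʳ-∣ : ∀ {a b} → a + b ≡ₚ b → p ∣ a
  +-cancelʳ-∣ {a} {b} a+b≡b = ∣m+n∣m⇒∣n (subst (p ∣_) (+-comm a (p * b)) p∣a+pb) (m∣m*n b)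
    where
    pb≡ : b + pred p * b ≡ p * b
    pb≡ = cong (_* b) (suc-pred p)
    p∣a+pb : p ∣ a + p * b
    p∣a+pb = ≡ₚ-∣ (trans (cong (_% p) (trans (cong (a +_) (sym pb≡)) (sym (+-assoc a b (pred p * b)))))
      (trans (+-congₚ {a + b} {b} {pred p * b} {pred p * b} a+b≡b refl) (cong (_% p) pb≡))) (m∣m*n b)

  module Center {g g′ m q : ℕ} (D : CenterData g g′ m q) where
    open CenterData D public

    g≤m : g ≤ m
    g≤m = p∤C⇒≤ m g p∤mCg

    g′≤m : g′ ≤ m
    g′≤m = ≤-trans (m≤n+m g′ g₀) (≤-reflexive (sym m≡))

    total : g + g′ ≡ m + q
    total = trans (cong (_+ g′) g≡) (trans (shuffle g₀ q g′) (cong (_+ q) (sym m≡)))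
      where
      shuffle : ∀ a b c → a + b + c ≡ a + c + b
      shuffle = ℕ-Solver.solve-∀

    -- This is m - g, the exponent of y next to x^g in (x+y)^m; written as g′ - q it is visibly
    -- below g′.
    r : ℕ
    r = g′ ∸ q

    q+r≡g′ : q + r ≡ g′
    q+r≡g′ = m+[n∸m]≡n q≤g′

    g+r≡m : g + r ≡ m
    g+r≡m = trans (cong (_+ r) g≡) (trans (+-assoc g₀ q r) (trans (cong (g₀ +_) q+r≡g′) (sym m≡)))

    r<g′ : r < g′
    r<g′ = ∸-monoʳ-< 0<q q≤g′

    g₀<g : g₀ < g
    g₀<g = <-≤-trans (m<m+n g₀ 0<q) (≤-reflexive (sym g≡))

    m<g+g′ : m < g + g′
    m<g+g′ = <-≤-trans (m<m+n m 0<q) (≤-reflexive (sym total))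

    -- Since i + j = m = g₀ + g′, the bound j < g′ amounts to g₀ < i.
    gap : ∀ i j → i + j ≡ m → i < g → j < g′ → p ∣ m C i
    gap i j i+j≡m i<g j<g′ = p∣between (+-cancelʳ-< g′ g₀ i
      (≤-<-trans (≤-reflexive (trans (sym m≡) (sym i+j≡m))) (+-monoʳ-< i j<g′))) i<g

    gap-xyPow : ∀ i j → i + j ≡ m → i < g → j < g′ → p ∣ xyPow m i j
    gap-xyPow i j i+j≡m i<g j<g′ = subst (p ∣_) (sym (xyPow-on m i j i+j≡m)) (gap i j i+j≡m i<g j<g′)

    xyPow-at-g : xyPow m g r ≡ m C g
    xyPow-at-g = xyPow-on m g r g+r≡m

    xyPow-at-g₀ : xyPow m g₀ g′ ≡ m C g₀
    xyPow-at-g₀ = xyPow-on m g₀ g′ (sym m≡)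

    HasΔ-center : HasΔ (g , g′ , m) q
    HasΔ-center = B.θ₁ , m , B.θ₂ , g + g′ , B.basis ,
      trans (sym (∣m-m+n∣≡n m q)) (cong (∣ m -_∣) (sym total))
      where module B = SplitBasis g g′ m gap

    balanced : Balanced (g , g′ , m)
    balanced = half g (≤-trans (m≤m+n (g + g) g′) (≤-trans (≤-reflexive (shuffle₁ g g′)) (+-monoʳ-≤ (g + g′) g≤m)))
             , half g′ (≤-trans (m≤m+n (g′ + g′) g) (≤-trans (≤-reflexive (shuffle₂ g g′)) (+-monoʳ-≤ (g + g′) g′≤m)))
             , half m (+-monoˡ-≤ m (<⇒≤ m<g+g′))
      where
      half : ∀ n {N} → n + n ≤ N → 2 * n ≤ N
      half n = ≤-trans (≤-reflexive (cong (n +_) (+-identityʳ n)))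
      shuffle₁ : ∀ a b → a + a + b ≡ a + b + a
      shuffle₁ = ℕ-Solver.solve-∀
      shuffle₂ : ∀ a b → b + b + a ≡ a + b + b
      shuffle₂ = ℕ-Solver.solve-∀

  module _ {g g′ m q : ℕ} (D : CenterData g g′ m q) where
    open Center D

    -- Degree m is excluded by the monomial x^g y^r, now below the first exponent. The pair comes
    -- from x (x+y)^m and y^q (x+y)^m: the factor x shifts the gap by one to fit g + 1, and degree m
    -- + q = g + g′ has no monomial with i ≤ g and j < g′. As x (x+y)^m has no pure power of y, the
    -- determinant coefficient is C(m, g).
    Δ-up₁ : ∀ δ → HasΔ (suc g , g′ , m) δ → δ < q
    Δ-up₁ = Δ-bound (suc m)
      (λ θ d θ∈ h d<L → low-degree-vanishes {suc g} {g′} {m} {d} {θ} θ∈ h (s≤s⁻¹ d<L)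
        (≤-<-trans (s≤s⁻¹ d<L) (<-trans m<g+g′ (n<1+n (g + g′))))
        (λ _ → g , r , n<1+n g , r<g′ , g+r≡m , p∤mCg))
      (split-pair (suc g) g′ m 1 q r (pred g′) {xPow 1} {yPow q} (xPow-homog 1) (yPow-homog q)
        gap₁
        (λ i j i+j≡ i≤g j<g′ → ⊥-elim (<⇒≢ (+-mono-≤-< (s≤s⁻¹ i≤g) j<g′) (trans i+j≡ (sym total))))
        (trans (cong suc g+r≡m) (+-comm 1 m))
        (trans (sym (+-suc g (pred g′))) (trans (cong (g +_) g′≡) total))
        (trans (cong (_+ q) (+-comm m 1)) (cong suc (sym total)))
        nondegenerate)
      (≤-reflexive (trans (cong (λ z → suc (suc (z + m))) total) (shuffle m q)))
      where
      g′≡ : suc (pred g′) ≡ g′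
      g′≡ = suc-pred g′ {{>-nonZero (<-≤-trans 0<q q≤g′)}}
      shuffle : ∀ m q → suc (suc (m + q + m)) ≡ suc m + suc m + q
      shuffle = ℕ-Solver.solve-∀
      gap₁ : ∀ i j → i + j ≡ m + 1 → i < suc g → j < g′ → p ∣ (xyPow m ⊗ xPow 1) i j
      gap₁ zero j _ _ _ = xy⊗x-below m 1 j z<s
      gap₁ (suc i) j i+j≡ (s≤s i<g) j<g′ = ≡ₚ-∣ (xy⊗x-shift m 1 i j)
        (gap-xyPow i j (suc-injective (trans i+j≡ (+-comm m 1))) i<g j<g′)
      nondegenerate : ¬ ((xyPow m ⊗ xPow 1) (suc g) r * (xyPow m ⊗ yPow q) 0 (m + q)
        ≡ₚ (xyPow m ⊗ yPow q) (suc g) (pred g′) * (xyPow m ⊗ xPow 1) 0 (m + 1))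
      nondegenerate eq = p∤mCg (≡ₚ-∣ (trans (sym lhs) eq) (∣n⇒∣m*n ((xyPow m ⊗ yPow q) (suc g) (pred g′)) (xy⊗x-below m 1 (m + 1) z<s)))
        where
        top : (xyPow m ⊗ yPow q) 0 (m + q) ≡ₚ 1
        top = trans (cong (λ z → (xyPow m ⊗ yPow q) 0 z % p) (+-comm m q))
          (trans (xy⊗y-shift m q 0 m) (cong (_% p) (xyPow-on m 0 m refl)))
        lhs : (xyPow m ⊗ xPow 1) (suc g) r * (xyPow m ⊗ yPow q) 0 (m + q) ≡ₚ m C g
        lhs = trans (*-congₚ {(xyPow m ⊗ xPow 1) (suc g) r} {m C g} {(xyPow m ⊗ yPow q) 0 (m + q)} {1}
            (trans (xy⊗x-shift m 1 g r) (cong (_% p) xyPow-at-g)) top)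
          (cong (_% p) (*-identityʳ (m C g)))

    -- The other end of the gap takes over: x^g₀ y^g′ is the obstruction in degree m. The pair comes
    -- from y (x+y)^m and x^q (x+y)^m; only the first has a pure power of y, and x^q moves C(m, g₀)
    -- to the row of x^g.
    Δ-up₂ : ∀ δ → HasΔ (g , suc g′ , m) δ → δ < q
    Δ-up₂ = Δ-bound (suc m)
      (λ θ d θ∈ h d<L → low-degree-vanishes {g} {suc g′} {m} {d} {θ} θ∈ h (s≤s⁻¹ d<L)
        (≤-<-trans (s≤s⁻¹ d<L) (<-≤-trans m<g+g′ (+-monoʳ-≤ g (n≤1+n g′))))
        (λ _ → g₀ , g′ , g₀<g , n<1+n g′ , sym m≡ , p∤mCg₀))
      (split-pair g (suc g′) m 1 q (suc r) g′ {yPow 1} {xPow q} (yPow-homog 1) (xPow-homog q)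
        gap₁
        (λ i j i+j≡ i<g j≤g′ → ⊥-elim (<⇒≢ (+-mono-<-≤ i<g (s≤s⁻¹ j≤g′)) (trans i+j≡ (sym total))))
        (trans (+-suc g r) (trans (cong suc g+r≡m) (+-comm 1 m)))
        total
        (trans (cong (_+ q) (+-comm m 1)) (trans (cong suc (sym total)) (sym (+-suc g g′))))
        nondegenerate)
      (≤-reflexive (trans (cong (λ z → suc (z + m)) (trans (+-suc g g′) (cong suc total))) (shuffle m q)))
      where
      shuffle : ∀ m q → suc (suc (m + q + m)) ≡ suc m + suc m + q
      shuffle = ℕ-Solver.solve-∀
      gap₁ : ∀ i j → i + j ≡ m + 1 → i < g → j < suc g′ → p ∣ (xyPow m ⊗ yPow 1) i j
      gap₁ i zero _ _ _ = xy⊗y-below m 1 i z<s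
      gap₁ i (suc j) i+j≡ i<g (s≤s j<g′) = ≡ₚ-∣ (xy⊗y-shift m 1 i j)
        (gap-xyPow i j (suc-injective (trans (sym (+-suc i j)) (trans i+j≡ (+-comm m 1)))) i<g j<g′)
      nondegenerate : ¬ ((xyPow m ⊗ yPow 1) g (suc r) * (xyPow m ⊗ xPow q) 0 (m + q)
        ≡ₚ (xyPow m ⊗ xPow q) g g′ * (xyPow m ⊗ yPow 1) 0 (m + 1))
      nondegenerate eq = p∤mCg₀ (≡ₚ-∣ (trans (sym rhs) (sym eq)) (∣n⇒∣m*n ((xyPow m ⊗ yPow 1) g (suc r)) (xy⊗x-below m q (m + q) 0<q)))
        where
        top : (xyPow m ⊗ yPow 1) 0 (m + 1) ≡ₚ 1
        top = trans (cong (λ z → (xyPow m ⊗ yPow 1) 0 z % p) (+-comm m 1))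
          (trans (xy⊗y-shift m 1 0 m) (cong (_% p) (xyPow-on m 0 m refl)))
        at-g : (xyPow m ⊗ xPow q) g g′ ≡ₚ m C g₀
        at-g = trans (cong (λ z → (xyPow m ⊗ xPow q) z g′ % p) (trans g≡ (+-comm g₀ q)))
          (trans (xy⊗x-shift m q g₀ g′) (cong (_% p) xyPow-at-g₀))
        rhs : (xyPow m ⊗ xPow q) g g′ * (xyPow m ⊗ yPow 1) 0 (m + 1) ≡ₚ m C g₀
        rhs = trans (*-congₚ {(xyPow m ⊗ xPow q) g g′} {m C g₀} {(xyPow m ⊗ yPow 1) 0 (m + 1)} {1} at-g top)
          (cong (_% p) (*-identityʳ (m C g₀)))

    -- By Pascal's rule (x+y)^(m+1) inherits the gap of (x+y)^m, so the pair of `SplitBasis` serves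
    -- again; degrees up to m stay below the third exponent.
    Δ-up₃ : ∀ δ → HasΔ (g , g′ , suc m) δ → δ < q
    Δ-up₃ = Δ-bound (suc m)
      (λ θ d θ∈ h d<L → low-degree-vanishes {g} {g′} {suc m} {d} {θ} θ∈ h (<⇒≤ d<L)
        (≤-<-trans (s≤s⁻¹ d<L) m<g+g′) (λ d≡1+m → ⊥-elim (<⇒≢ d<L d≡1+m)))
      (SplitBasis.pair g g′ (suc m) gap₁)
      (≤-reflexive (trans (cong (λ z → suc (z + suc m)) total) (shuffle m q)))
      where
      shuffle : ∀ m q → suc (m + q + suc m) ≡ suc m + suc m + q
      shuffle = ℕ-Solver.solve-∀
      gap₁ : ∀ i j → i + j ≡ suc m → i < g → j < g′ → p ∣ suc m C i
      gap₁ zero j j≡ _ j<g′ = ⊥-elim (<⇒≱ j<g′ (≤-trans g′≤m (≤-trans (n≤1+n m) (≤-reflexive (sym j≡)))))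
      gap₁ (suc i) zero i≡ i<g _ = ⊥-elim (<⇒≱ i<g (≤-trans g≤m (≤-trans (n≤1+n m) (≤-reflexive (trans (sym i≡) (+-identityʳ (suc i)))))))
      gap₁ (suc i) (suc j) i+j≡ i<g j<g′ = subst (p ∣_) (nCk+nC[k+1]≡[n+1]C[k+1] m i)
        (∣m∣n⇒∣m+n (gap i (suc j) (suc-injective i+j≡) (<⇒≤ i<g) j<g′)
                   (gap (suc i) j (suc-injective (trans (cong suc (sym (+-suc i j))) i+j≡)) i<g (<⇒≤ j<g′)))

  -- Lowering the first exponent only shrinks the region of the gap, so the pair of `SplitBasis`
  -- remains available; with L = m all excluded degrees lie below the third exponent.
  Δ-down₁ : ∀ {g g′ m q} → CenterData (suc g) g′ m q → ∀ δ → HasΔ (g , g′ , m) δ → δ < q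
  Δ-down₁ {g} {g′} {m} {q} D = Δ-bound m
    (λ θ d θ∈ h d<m → low-degree-vanishes {g} {g′} {m} {d} {θ} θ∈ h (<⇒≤ d<m)
      (<-≤-trans d<m (s≤s⁻¹ m<g+g′)) (λ d≡m → ⊥-elim (<⇒≢ d<m d≡m)))
    (SplitBasis.pair g g′ m (λ i j i+j≡m i<g j<g′ → gap i j i+j≡m (m<n⇒m<1+n i<g) j<g′))
    (≤-reflexive (trans (cong (_+ m) total) (shuffle m q)))
    where
    open Center D
    shuffle : ∀ m q → m + q + m ≡ m + m + q
    shuffle = ℕ-Solver.solve-∀

  Δ-down₂ : ∀ {g g′ m q} → CenterData g (suc g′) m q → ∀ δ → HasΔ (g , g′ , m) δ → δ < q
  Δ-down₂ {g} {g′} {m} {q} D = Δ-bound m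
    (λ θ d θ∈ h d<m → low-degree-vanishes {g} {g′} {m} {d} {θ} θ∈ h (<⇒≤ d<m)
      (<-≤-trans d<m (s≤s⁻¹ (≤-trans m<g+g′ (≤-reflexive (+-suc g g′))))) (λ d≡m → ⊥-elim (<⇒≢ d<m d≡m)))
    (SplitBasis.pair g g′ m (λ i j i+j≡m i<g j<g′ → gap i j i+j≡m i<g (m<n⇒m<1+n j<g′)))
    (≤-reflexive (trans (cong (_+ m) (trans (sym (+-suc g g′)) total)) (shuffle m q)))
    where
    open Center D
    shuffle : ∀ m q → m + q + m ≡ m + m + q
    shuffle = ℕ-Solver.solve-∀

  -- The centre has third coordinate m + 1, so degree m itself must be excluded; the obstruction is
  -- x^(g-1) y^r with coefficient C(m, g-1). The pair comes from (x+y)^(m+1), which has the gap of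
  -- the centre, and y^q (x+y)^m, whose degree g + g′ - 1 leaves no room for one. The determinant
  -- coefficient C(m+1, g) - C(m, g) is again C(m, g-1).
  Δ-down₃ : ∀ {g g′ m q} → CenterData g g′ (suc m) q → ∀ δ → HasΔ (g , g′ , m) δ → δ < q
  Δ-down₃ {g} {g′} {m} {q} D = Δ-bound (suc m)
    (λ θ d θ∈ h d<L → low-degree-vanishes {g} {g′} {m} {d} {θ} θ∈ h (s≤s⁻¹ d<L)
      (<-trans d<L m<g+g′)
      (λ _ → pred g , r , ≤-reflexive g≡suc , r<g′ , suc-injective (trans (cong (_+ r) g≡suc) g+r≡m) , p∤[m-1]C[g-1]′))
    (split-pair g g′ m 1 q r (pred g′) {xyPow 1} {yPow q} (xyPow-homog 1) (yPow-homog q)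
      (λ i j i+j≡ i<g j<g′ → ≡ₚ-∣ (xy⊗xy m i j) (gap-xyPow i j (trans i+j≡ (+-comm m 1)) i<g j<g′))
      (λ i j i+j≡ i<g j<g′ → ⊥-elim (<⇒≱ (≤-trans (s≤s (≤-reflexive (sym (+-suc i j)))) (+-mono-≤ i<g j<g′))
        (≤-reflexive (trans total (cong suc (sym i+j≡))))))
      (trans g+r≡m (+-comm 1 m))
      (suc-injective (trans (sym (+-suc g (pred g′))) (trans (cong (g +_) g′≡suc) total)))
      (trans (cong (_+ q) (+-comm m 1)) (sym total))
      nondegenerate)
    (≤-reflexive (trans (cong (λ z → suc (z + m)) total) (shuffle m q)))
    where
    open Center D
    shuffle : ∀ m q → suc (suc m + q + m) ≡ suc m + suc m + q
    shuffle = ℕ-Solver.solve-∀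
    g≡suc : suc (pred g) ≡ g
    g≡suc = suc-pred g {{>-nonZero (≤-<-trans z≤n g₀<g)}}
    g′≡suc : suc (pred g′) ≡ g′
    g′≡suc = suc-pred g′ {{>-nonZero (<-≤-trans 0<q q≤g′)}}
    p∤[m-1]C[g-1]′ : ¬ p ∣ m C pred g
    p∤[m-1]C[g-1]′ p∣ = p∤[m-1]C[g-1] (subst (λ z → p ∣ m C (z ∸ 1)) g≡suc p∣)
    nondegenerate : ¬ ((xyPow m ⊗ xyPow 1) g r * (xyPow m ⊗ yPow q) 0 (m + q)
      ≡ₚ (xyPow m ⊗ yPow q) g (pred g′) * (xyPow m ⊗ xyPow 1) 0 (m + 1))
    nondegenerate eq = p∤[m-1]C[g-1]′ (+-cancelʳ-∣ {m C pred g} {m C g} (begin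
      (m C pred g + m C g) % p          ≡⟨ cong (λ z → (m C pred g + m C z) % p) g≡suc ⟨
      (m C pred g + m C suc (pred g)) % p  ≡⟨ cong (_% p) (nCk+nC[k+1]≡[n+1]C[k+1] m (pred g)) ⟩
      (suc m C suc (pred g)) % p        ≡⟨ cong (λ z → (suc m C z) % p) g≡suc ⟩
      (suc m C g) % p                   ≡⟨ cong (_% p) (*-identityʳ (suc m C g)) ⟨
      ((suc m C g) * 1) % p             ≡⟨ *-congₚ {s₁ g r} {suc m C g} {s₂ 0 (m + q)} {1} s₁-g s₂-0 ⟨
      (s₁ g r * s₂ 0 (m + q)) % p       ≡⟨ eq ⟩
      (s₂ g (pred g′) * s₁ 0 (m + 1)) % p  ≡⟨ *-congₚ {s₂ g (pred g′)} {m C g} {s₁ 0 (m + 1)} {1} s₂-g s₁-0 ⟩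
      ((m C g) * 1) % p                 ≡⟨ cong (_% p) (*-identityʳ (m C g)) ⟩
      (m C g) % p                       ∎))
      where
      open ≡-Reasoning
      s₁ = xyPow m ⊗ xyPow 1
      s₂ = xyPow m ⊗ yPow q
      s₁-g : s₁ g r ≡ₚ suc m C g
      s₁-g = trans (xy⊗xy m g r) (cong (_% p) xyPow-at-g)
      s₁-0 : s₁ 0 (m + 1) ≡ₚ 1
      s₁-0 = trans (xy⊗xy m 0 (m + 1)) (cong (_% p) (xyPow-on (suc m) 0 (m + 1) (+-comm m 1)))
      s₂-0 : s₂ 0 (m + q) ≡ₚ 1
      s₂-0 = trans (cong (λ z → s₂ 0 z % p) (+-comm m q))
        (trans (xy⊗y-shift m q 0 m) (cong (_% p) (xyPow-on m 0 m refl)))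
      -- The exponent g′ - 1 of y is q + (r - 1) if r > 0. For r = 0 it is below q, so the
      -- coefficient vanishes, and so does C(m, g) because g = m + 1.
      s₂-at : ∀ k → k ≡ r → s₂ g (pred g′) ≡ₚ m C g
      s₂-at zero 0≡r = ∣∣⇒≡ₚ (xy⊗y-below m q g (≤-reflexive (trans g′≡suc g′≡q)))
        (subst (p ∣_) (sym (k>n⇒nCk≡0 (≤-reflexive (sym g≡1+m)))) (p ∣0))
        where
        g′≡q : g′ ≡ q
        g′≡q = trans (sym q+r≡g′) (trans (cong (q +_) (sym 0≡r)) (+-identityʳ q))
        g≡1+m : g ≡ suc m
        g≡1+m = trans (sym (+-identityʳ g)) (trans (cong (g +_) 0≡r) g+r≡m)
      s₂-at (suc k) 1+k≡r = trans (cong (λ z → s₂ g z % p) pred-g′≡)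
        (trans (xy⊗y-shift m q g k) (cong (_% p) (xyPow-on m g k g+k≡m)))
        where
        pred-g′≡ : pred g′ ≡ q + k
        pred-g′≡ = cong pred (trans (sym q+r≡g′) (trans (cong (q +_) (sym 1+k≡r)) (+-suc q k)))
        g+k≡m : g + k ≡ m
        g+k≡m = suc-injective (trans (sym (+-suc g k)) (trans (cong (g +_) 1+k≡r) g+r≡m))
      s₂-g : s₂ g (pred g′) ≡ₚ m C g
      s₂-g = s₂-at r refl

  CenterData⇒InZ : ∀ {g g′ m q} → CenterData g g′ m q → InZ q (g , g′ , m)
  CenterData⇒InZ {g} {g′} {m} {q} D = balanced , HasΔ-center , 0<q , neighbours D
    where
    open Center D
    -- The coordinates are quantified afresh so that matching on a downward step can refine one of
    -- them to a successor.
    neighbours : ∀ {g g′ m} → CenterData g g′ m q → ∀ ν → Adjacent (g , g′ , m) ν → ∀ δ → HasΔ ν δ → δ < q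
    neighbours D _ (inj₁ up₁) = Δ-up₁ D
    neighbours D _ (inj₁ up₂) = Δ-up₂ D
    neighbours D _ (inj₁ up₃) = Δ-up₃ D
    neighbours D _ (inj₂ up₁) = Δ-down₁ D
    neighbours D _ (inj₂ up₂) = Δ-down₂ D
    neighbours D _ (inj₂ up₃) = Δ-down₃ D

theorem5p18 : (p : ℕ) (pr : Prime p) → let open Char p pr in
    (m : ℕ) → 0 < m → (g g′ : ℕ) → InS m (g , g′ , m) →
    (e : ℕ) → IsS g e → m + p ^ e ≡ g + g′ →
    InZ (p ^ e) (g , g′ , m)
theorem5p18 p pr m 0<m g g′ κ∈S e isS m+q≡ =
  Neighbours.CenterData⇒InZ p pr (BinomialMod.InS⇒CenterData p pr 0<m κ∈S isS m+q≡)
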